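{- Let $m$ be a positive integer, let $t\ge 0$ be an integer, and let $\{(A_i,B_i)\}_{i=1}^m$ be a collection of pairs of finite sets such that $|A_i|=a_i\le |B_i|=b_i$ for every $1\le i\le m$. Suppose that \begin{itemize} \item $|A_i\cap A_j|>t$ for all $1\le i,j\le m$ (including $i=j$), \item $|A_i\cap B_i|\le t$ for all $1\le i\le m$, \item $|A_i\cap B_j|>t$ for all $1\le i<j\le m$, \item $a_i+b_i=N$ for all $1\le i\le m$ and some positive integer $N$, and $a_1\le a_2\le\cdots\le a_m$. \end{itemize} Then $$\sum_{i=1}^m \binom{N-(2t+1)}{a_i-(t+1)}^{ -1}\le 1.$$ -}

module Defs where

open import Data.Fin.Subset using (Subset; _∩_; ∣_∣)
open import Data.Fin.Subset.Properties using (∩-idem)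
open import Data.Nat using (ℕ; suc; _+_; _*_; _∸_; _≤_; _<_; _>_; NonZero; _!; >-nonZero)
open import Data.Nat.Combinatorics using (_C_; nCk≡n!/k![n-k]!; k![n∸k]!∣n!)
open import Data.Nat.Divisibility using (∣⇒≤)
open import Data.Nat.DivMod using (m≥n⇒m/n>0)
open import Data.Nat.Properties
open import Data.Nat.Solver using (module +-*-Solver)
open import Relation.Binary.PropositionalEquality using (_≡_; refl; sym; trans; cong; subst)

private
  k≤n⇒nCk>0 : ∀ {n k} → k ≤ n → n C k > 0
  k≤n⇒nCk>0 {n} {k} k≤n = subst (_> 0) (sym (nCk≡n!/k![n-k]! k≤n))
    (m≥n⇒m/n>0 (∣⇒≤ (k![n∸k]!∣n! k≤n)))
    where instance
      _ = k !* (n ∸ k) !≢0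
      _ = n !≢0

  sum-of-bounds : ∀ t x y → (x + (t + 1)) + (y + (t + 1)) ≡ (2 * t + 1) + (x + (y + 1))
  sum-of-bounds = solve 3
    (λ t x y → (x :+ (t :+ con 1)) :+ (y :+ (t :+ con 1)) :=
               (con 2 :* t :+ con 1) :+ (x :+ (y :+ con 1))) refl
    where open +-*-Solver

  excess : ∀ {N t a b} → t < a → a ≤ b → a + b ≡ N →
           N ≡ (2 * t + 1) + ((a ∸ (t + 1)) + ((b ∸ (t + 1)) + 1))
  excess {N} {t} {a} {b} t<a a≤b a+b≡N = begin
    N                                                        ≡⟨ sym a+b≡N ⟩
    a + b                                                    ≡⟨ cong (_+ b) (sym (m∸n+n≡m t+1≤a)) ⟩
    (a ∸ (t + 1) + (t + 1)) + b                              ≡⟨ cong ((a ∸ (t + 1) + (t + 1)) +_) (sym (m∸n+n≡m (≤-trans t+1≤a a≤b))) ⟩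
    (a ∸ (t + 1) + (t + 1)) + (b ∸ (t + 1) + (t + 1))        ≡⟨ sum-of-bounds t (a ∸ (t + 1)) (b ∸ (t + 1)) ⟩
    (2 * t + 1) + ((a ∸ (t + 1)) + ((b ∸ (t + 1)) + 1))      ∎
    where
    open Relation.Binary.PropositionalEquality.≡-Reasoning
    t+1≤a : t + 1 ≤ a
    t+1≤a = subst (_≤ a) (+-comm 1 t) t<a

module _ {n N t : ℕ} (A B : Subset n) (t<∣A∩A∣ : ∣ A ∩ A ∣ > t)
         (∣A∣≤∣B∣ : ∣ A ∣ ≤ ∣ B ∣) (∣A∣+∣B∣≡N : ∣ A ∣ + ∣ B ∣ ≡ N) where

  private
    t<∣A∣ : t < ∣ A ∣
    t<∣A∣ = subst (λ S → t < ∣ S ∣) (∩-idem A) t<∣A∩A∣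

    N≡ : N ≡ (2 * t + 1) + ((∣ A ∣ ∸ (t + 1)) + ((∣ B ∣ ∸ (t + 1)) + 1))
    N≡ = excess t<∣A∣ ∣A∣≤∣B∣ ∣A∣+∣B∣≡N

  -- Neither subtraction in the binomial coefficient below is truncated.

  t+1≤∣A∣ : t + 1 ≤ ∣ A ∣
  t+1≤∣A∣ = subst (_≤ ∣ A ∣) (+-comm 1 t) t<∣A∣

  2t+1≤N : 2 * t + 1 ≤ N
  2t+1≤N = subst (2 * t + 1 ≤_) (sym N≡) (m≤m+n _ _)

  binomial-nonZero : NonZero ((N ∸ (2 * t + 1)) C (∣ A ∣ ∸ (t + 1)))
  binomial-nonZero = >-nonZero (k≤n⇒nCk>0
    (subst (∣ A ∣ ∸ (t + 1) ≤_)
      (sym (trans (cong (_∸ (2 * t + 1)) N≡) (m+n∸m≡n (2 * t + 1) _)))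
      (m≤m+n _ _)))

{-# OPTIONS --safe #-}
module Submission where

-- Over ℤ, put the ground set in general position in ℤ^(t + n), n = N − 2t, and let
-- ω_S be the coefficient of x₁ ∧ … ∧ x_t in the product of the vectors of S. Then
-- ω_S ∧ ω_T vanishes if ∣S ∩ T∣ > t, and ω_{A i} ∧ ω_{B i} ≠ 0. The latter is arranged
-- modulo one of m coprime integers for each i, where unit vectors can be used.
-- Reducing ω_{A i} modulo the ideal of its predecessors yields leading monomials
-- S i of degree a i − t. Leading monomials of disjoint support multiply, so the S i
-- pairwise intersect (as ω_{A i} ∧ ω_{A j} = 0) and form an antichain. The inequality
-- is thus that of Greene, Katona and Kleitman for intersecting antichains.

open import Defs using (binomial-nonZero; t+1≤∣A∣; 2t+1≤N)
open import Algebra.Bundles using (AbelianGroup)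
open import Algebra.Structures using (IsAbelianGroup)
open import Data.Bool as Bool using (true; false)
open import Data.Empty using (⊥-elim)
open import Data.Fin as Fin using (Fin; toℕ; fromℕ<)
import Data.Fin.Properties as Fin
open import Data.Fin.Subset using (Subset; _∩_; _∪_; ∣_∣; _⊆_; ∁; _∈_; _∉_; ⁅_⁆) renaming (⊥ to ∅)
import Data.Fin.Subset.Properties as Sub
open import Data.Integer as ℤ using (ℤ; 0ℤ; 1ℤ)
import Data.Integer.Properties as ℤ
import Data.Integer.Tactic.RingSolver as ℤ-Solver
open import Data.List using (List; []; _∷_; length)
open import Data.Nat as ℕ using (ℕ; zero; suc; z≤n; s≤s; _+_; _*_; _∸_; _≤_; _<_; _>_; NonZero; _!)
open import Data.Nat.Combinatorics using (_C_; nCk≡n!/k![n-k]!; k![n∸k]!∣n!)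
open import Data.Nat.Divisibility using (m∣m*n; ∣-trans; m≤n⇒m!∣n!)
import Data.Nat.Properties as ℕ
import Data.Nat.Tactic.RingSolver as ℕ-Solver
open import Data.Product using (∃; ∃₂; _×_; _,_; proj₁; proj₂)
open import Data.Rational as ℚ using (1ℚ; toℚᵘ)
open import Data.Rational.Properties as ℚ using (+-0-monoid)
open import Data.Rational.Unnormalised as ℚᵘ using (mkℚᵘ; *≡*; *≤*)
import Data.Rational.Unnormalised.Properties as ℚᵘ
open import Data.Sum using (_⊎_; inj₁; inj₂)
open import Data.Unit using (⊤; tt)
open import Data.Vec as Vec using (Vec; []; _∷_; here; there; insertAt; removeAt; lookup)
open import Data.Vec.Properties using (≡-dec; insertAt-lookup; removeAt-insertAt; insertAt-removeAt)
open import Data.Vec.Relation.Binary.Pointwise.Inductive using (Pointwise; []; _∷_)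
open import Function using (_∘_)
open import Relation.Binary.Definitions using (tri<; tri≈; tri>)
open import Relation.Binary.PropositionalEquality hiding (J)
open import Relation.Nullary using (¬_; Dec; yes; no; contradiction)
open import Relation.Nullary.Decidable using (decidable-stable; ¬¬-excluded-middle; _⊎-dec_; _×-dec_)
open import Relation.Unary using (Decidable)
import Algebra.Properties.Semiring.Sum ℕ.+-*-semiring as ∑ℕ

-- The cycle method

-- The degrees a_i - t and b_i - t add up to n = N - 2t, and a_i ≤ b_i makes a_i - t at most n / 2,
-- as the inequality for intersecting antichains requires. That inequality fixes one more point of
-- the ground set, and this turns n and a_i - t into the entries N - (2t + 1) and a_i - (t + 1) of
-- the binomial coefficient. Sizes differ, so a count of independent forms is not enough: actual
-- sets are needed, and leading monomials supply them. Two obstacles shape the algebra. General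
-- position asks one choice of vectors to make m polynomials nonzero at once; over ℤ, separate
-- choices for each i can be glued by remaindering. The price of ℤ is the lack of division, so
-- elimination and reduction carry nonzero multipliers, which torsion-freeness cancels.

module CycleMethod where

  open import Data.Nat.DivMod
  open ∑ℕ using (sum; sum-syntax; ∑-comm; sum-cong-≗; sum-replicate-zero; *-distribˡ-sum; *-distribʳ-sum)

  private variable
    n m : ℕ

  -- Indicators and finite sums

  ⟦_⟧ : ∀ {P : Set} → Dec P → ℕ
  ⟦ yes _ ⟧ = 1
  ⟦ no  _ ⟧ = 0

  ⟦⟧≤1 : ∀ {P : Set} (P? : Dec P) → ⟦ P? ⟧ ≤ 1
  ⟦⟧≤1 (yes _) = ℕ.≤-refl
  ⟦⟧≤1 (no _)  = z≤n

  ⟦⟧>0⇒ : ∀ {P : Set} (P? : Dec P) → 0 < ⟦ P? ⟧ → P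
  ⟦⟧>0⇒ (yes p) _ = p

  ⟦⟧-true : ∀ {P : Set} (P? : Dec P) → P → ⟦ P? ⟧ ≡ 1
  ⟦⟧-true (yes _) _ = refl
  ⟦⟧-true (no ¬p) p = contradiction p ¬p

  ⟦⟧-⇔ : ∀ {P Q : Set} (P? : Dec P) (Q? : Dec Q) → (P → Q) → (Q → P) → ⟦ P? ⟧ ≡ ⟦ Q? ⟧
  ⟦⟧-⇔ (yes p) Q? P⇒Q Q⇒P = sym (⟦⟧-true Q? (P⇒Q p))
  ⟦⟧-⇔ (no ¬p) (yes q) P⇒Q Q⇒P = contradiction (Q⇒P q) ¬p
  ⟦⟧-⇔ (no ¬p) (no ¬q) P⇒Q Q⇒P = refl

  sum-mono-≤ : {f g : Fin n → ℕ} → (∀ i → f i ≤ g i) → sum f ≤ sum g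
  sum-mono-≤ {zero}  f≤g = z≤n
  sum-mono-≤ {suc n} f≤g = ℕ.+-mono-≤ (f≤g Fin.zero) (sum-mono-≤ (f≤g ∘ Fin.suc))

  sum-const : ∀ n c → sum {n} (λ _ → c) ≡ n * c
  sum-const zero    c = refl
  sum-const (suc n) c = cong (c +_) (sum-const n c)

  sum>0⇒ : (f : Fin n → ℕ) → 0 < sum f → ∃ λ i → 0 < f i
  sum>0⇒ {suc n} f p with f Fin.zero in eq
  ... | suc _ = Fin.zero , subst (0 <_) (sym eq) (s≤s z≤n)
  ... | zero with sum>0⇒ (f ∘ Fin.suc) p
  ...   | i , q = Fin.suc i , q

  sum≤1 : (f : Fin n → ℕ) → (∀ i → f i ≤ 1) → (∀ i j → 0 < f i → 0 < f j → i ≡ j) → sum f ≤ 1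
  sum≤1 {zero} f f≤1 unique = z≤n
  sum≤1 {suc n} f f≤1 unique with f Fin.zero in eq
  ... | zero = sum≤1 (f ∘ Fin.suc) (f≤1 ∘ Fin.suc) (λ i j p q → Fin.suc-injective (unique _ _ p q))
  ... | suc c with sum (f ∘ Fin.suc) in eq′
  ...   | zero = subst (_≤ 1) (trans eq (sym (ℕ.+-identityʳ (suc c)))) (f≤1 Fin.zero)
  ...   | suc _ with sum>0⇒ (f ∘ Fin.suc) (subst (0 <_) (sym eq′) (s≤s z≤n))
  ...     | i , q with unique Fin.zero (Fin.suc i) (subst (0 <_) (sym eq) (s≤s z≤n)) q
  ...       | ()

  least : {P : Fin n → Set} → Decidable P → (∀ i → ¬ P i) ⊎ (∃ λ i → P i × (∀ j → P j → i Fin.≤ j))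
  least {zero} P? = inj₁ λ ()
  least {suc n} P? with P? Fin.zero
  ... | yes p = inj₂ (Fin.zero , p , λ _ _ → z≤n)
  ... | no ¬p with least (P? ∘ Fin.suc)
  ...   | inj₁ none = inj₁ λ { Fin.zero → ¬p ; (Fin.suc i) → none i }
  ...   | inj₂ (i , p , min) = inj₂ (Fin.suc i , p , λ { Fin.zero q → contradiction q ¬p ; (Fin.suc j) q → s≤s (min j q) })

  -- Permutations acting on subsets, coded by the successive insertion positions.
  data Permutation : ℕ → Set where
    []  : Permutation 0
    _∷_ : Fin (suc n) → Permutation n → Permutation (suc n)

  act : Permutation n → Subset n → Subset n
  act []      []      = []
  act (j ∷ σ) (b ∷ S) = insertAt (act σ S) j b

  ∑ᴾ : (Permutation n → ℕ) → ℕ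
  ∑ᴾ {zero}  f = f []
  ∑ᴾ {suc n} f = ∑[ j < suc n ] ∑ᴾ (λ σ → f (j ∷ σ))

  ∑ᴾ-cong : {f g : Permutation n → ℕ} → (∀ σ → f σ ≡ g σ) → ∑ᴾ f ≡ ∑ᴾ g
  ∑ᴾ-cong {zero}  f≡g = f≡g []
  ∑ᴾ-cong {suc n} f≡g = sum-cong-≗ (λ j → ∑ᴾ-cong (λ σ → f≡g (j ∷ σ)))

  ∑ᴾ-mono-≤ : {f g : Permutation n → ℕ} → (∀ σ → f σ ≤ g σ) → ∑ᴾ f ≤ ∑ᴾ g
  ∑ᴾ-mono-≤ {zero}  f≤g = f≤g []
  ∑ᴾ-mono-≤ {suc n} f≤g = sum-mono-≤ (λ j → ∑ᴾ-mono-≤ (λ σ → f≤g (j ∷ σ)))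

  ∑ᴾ-const : ∀ n c → ∑ᴾ {n} (λ _ → c) ≡ n ! * c
  ∑ᴾ-const zero    c = sym (ℕ.+-identityʳ c)
  ∑ᴾ-const (suc n) c = trans (sum-cong-≗ {suc n} (λ j → ∑ᴾ-const n c))
    (trans (sum-const (suc n) (n ! * c)) (sym (ℕ.*-assoc (suc n) (n !) c)))

  ∑ᴾ-*ʳ : ∀ (f : Permutation n → ℕ) c → ∑ᴾ (λ σ → f σ * c) ≡ ∑ᴾ f * c
  ∑ᴾ-*ʳ {zero}  f c = refl
  ∑ᴾ-*ʳ {suc n} f c = trans (sum-cong-≗ {suc n} (λ j → ∑ᴾ-*ʳ (λ σ → f (j ∷ σ)) c))
    (sym (*-distribʳ-sum c (λ j → ∑ᴾ (λ σ → f (j ∷ σ)))))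

  ∑ᴾ-∑ : ∀ (f : Fin m → Permutation n → ℕ) → ∑ᴾ (λ σ → ∑[ i < m ] f i σ) ≡ ∑[ i < m ] ∑ᴾ (f i)
  ∑ᴾ-∑ {n = zero}  f = refl
  ∑ᴾ-∑ {m} {suc n} f = trans (sum-cong-≗ {suc n} (λ j → ∑ᴾ-∑ (λ i σ → f i (j ∷ σ))))
    (∑-comm {suc n} {m} (λ j i → ∑ᴾ (λ σ → f i (j ∷ σ))))

  ∣insertAt∣ : ∀ (S : Subset n) j b → ∣ insertAt S j b ∣ ≡ ∣ b ∷ S ∣
  ∣insertAt∣ S Fin.zero b = refl
  ∣insertAt∣ (true  ∷ S) (Fin.suc j) true  = cong suc (∣insertAt∣ S j true)
  ∣insertAt∣ (true  ∷ S) (Fin.suc j) false = cong suc (∣insertAt∣ S j false)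
  ∣insertAt∣ (false ∷ S) (Fin.suc j) true  = ∣insertAt∣ S j true
  ∣insertAt∣ (false ∷ S) (Fin.suc j) false = ∣insertAt∣ S j false

  insertAt-∩ : ∀ (S T : Subset n) j b c → insertAt S j b ∩ insertAt T j c ≡ insertAt (S ∩ T) j (b Bool.∧ c)
  insertAt-∩ S T Fin.zero b c = refl
  insertAt-∩ (x ∷ S) (y ∷ T) (Fin.suc j) b c = cong (x Bool.∧ y ∷_) (insertAt-∩ S T j b c)

  ∣∷∣-cong : ∀ b {S : Subset n} {T : Subset m} → ∣ S ∣ ≡ ∣ T ∣ → ∣ b ∷ S ∣ ≡ ∣ b ∷ T ∣
  ∣∷∣-cong true  eq = cong suc eq
  ∣∷∣-cong false eq = eq

  ∣∷∣-cancel : ∀ b {S : Subset n} {T : Subset m} → ∣ b ∷ S ∣ ≡ ∣ b ∷ T ∣ → ∣ S ∣ ≡ ∣ T ∣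
  ∣∷∣-cancel true  eq = ℕ.suc-injective eq
  ∣∷∣-cancel false eq = eq

  ∣act∣ : ∀ σ (S : Subset n) → ∣ act σ S ∣ ≡ ∣ S ∣
  ∣act∣ []      []      = refl
  ∣act∣ (j ∷ σ) (b ∷ S) = trans (∣insertAt∣ (act σ S) j b) (∣∷∣-cong b {act σ S} {S} (∣act∣ σ S))

  act-∩ : ∀ σ (S T : Subset n) → act σ S ∩ act σ T ≡ act σ (S ∩ T)
  act-∩ []      []      []      = refl
  act-∩ (j ∷ σ) (b ∷ S) (c ∷ T) = trans (insertAt-∩ (act σ S) (act σ T) j b c)
    (cong (λ R → insertAt R j (b Bool.∧ c)) (act-∩ σ S T))

  ∣act∩act∣ : ∀ σ (S T : Subset n) → ∣ act σ S ∩ act σ T ∣ ≡ ∣ S ∩ T ∣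
  ∣act∩act∣ σ S T = trans (cong ∣_∣ (act-∩ σ S T)) (∣act∣ σ (S ∩ T))

  _≟ˢ_ : (S T : Subset n) → Dec (S ≡ T)
  _≟ˢ_ = ≡-dec Bool._≟_

  ∑-lookup-true : (T : Subset n) → sum (λ j → ⟦ true Bool.≟ lookup T j ⟧) ≡ ∣ T ∣
  ∑-lookup-true []          = refl
  ∑-lookup-true (true  ∷ T) = cong suc (∑-lookup-true T)
  ∑-lookup-true (false ∷ T) = ∑-lookup-true T

  ∑-lookup-false : (T : Subset n) → sum (λ j → ⟦ false Bool.≟ lookup T j ⟧) ≡ ∣ ∁ T ∣
  ∑-lookup-false []          = refl
  ∑-lookup-false (true  ∷ T) = ∑-lookup-false T
  ∑-lookup-false (false ∷ T) = cong suc (∑-lookup-false T)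

  ∣removeAt∣ : ∀ {S : Subset n} (T : Subset (suc n)) j → ∣ lookup T j ∷ S ∣ ≡ ∣ T ∣ → ∣ S ∣ ≡ ∣ removeAt T j ∣
  ∣removeAt∣ {S = S} T j eq = ∣∷∣-cancel (lookup T j) {S} {removeAt T j} (begin
    ∣ lookup T j ∷ S ∣                              ≡⟨ eq ⟩
    ∣ T ∣                                           ≡⟨ cong ∣_∣ (insertAt-removeAt T j) ⟨
    ∣ insertAt (removeAt T j) j (lookup T j) ∣      ≡⟨ ∣insertAt∣ (removeAt T j) j (lookup T j) ⟩
    ∣ lookup T j ∷ removeAt T j ∣                   ∎)
    where open ≡-Reasoning

  -- Induction on the code of the permutation: the first entry b can only be inserted at a position
  -- where T has the value b, and deleting that position from T leaves the same problem for S. The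
  -- number of such positions is the leading factor of one of the two factorials.
  count-permutations : (S T : Subset n) → ∣ S ∣ ≡ ∣ T ∣ →
    ∑ᴾ (λ σ → ⟦ act σ S ≟ˢ T ⟧) ≡ ∣ S ∣ ! * ∣ ∁ S ∣ !
  count-permutations [] [] _ = refl
  count-permutations {suc n} (b ∷ S) T ∣S∣≡∣T∣ = begin
    ∑[ j < suc n ] ∑ᴾ (λ σ → ⟦ insertAt (act σ S) j b ≟ˢ T ⟧)
      ≡⟨ sum-cong-≗ position ⟩
    ∑[ j < suc n ] (⟦ b Bool.≟ lookup T j ⟧ * (∣ S ∣ ! * ∣ ∁ S ∣ !))
      ≡⟨ *-distribʳ-sum (∣ S ∣ ! * ∣ ∁ S ∣ !) (λ j → ⟦ b Bool.≟ lookup T j ⟧) ⟨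
    (∑[ j < suc n ] ⟦ b Bool.≟ lookup T j ⟧) * (∣ S ∣ ! * ∣ ∁ S ∣ !)
      ≡⟨ total b ∣S∣≡∣T∣ ⟩
    ∣ b ∷ S ∣ ! * ∣ ∁ (b ∷ S) ∣ !  ∎
    where
    open ≡-Reasoning
    position : ∀ j → ∑ᴾ (λ σ → ⟦ insertAt (act σ S) j b ≟ˢ T ⟧) ≡
                     ⟦ b Bool.≟ lookup T j ⟧ * (∣ S ∣ ! * ∣ ∁ S ∣ !)
    position j with b Bool.≟ lookup T j
    ... | yes refl = begin
      ∑ᴾ (λ σ → ⟦ insertAt (act σ S) j (lookup T j) ≟ˢ T ⟧)
        ≡⟨ ∑ᴾ-cong (λ σ → ⟦⟧-⇔ (_ ≟ˢ T) (act σ S ≟ˢ removeAt T j)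
             (λ eq → trans (sym (removeAt-insertAt (act σ S) j _)) (cong (λ R → removeAt R j) eq))
             (λ eq → trans (cong (λ R → insertAt R j (lookup T j)) eq) (insertAt-removeAt T j))) ⟩
      ∑ᴾ (λ σ → ⟦ act σ S ≟ˢ removeAt T j ⟧)
        ≡⟨ count-permutations S (removeAt T j) (∣removeAt∣ {S = S} T j ∣S∣≡∣T∣) ⟩
      ∣ S ∣ ! * ∣ ∁ S ∣ !
        ≡⟨ ℕ.+-identityʳ _ ⟨
      1 * (∣ S ∣ ! * ∣ ∁ S ∣ !) ∎
    ... | no b≢ = begin
      ∑ᴾ (λ σ → ⟦ insertAt (act σ S) j b ≟ˢ T ⟧)
        ≡⟨ ∑ᴾ-cong (λ σ → ⟦⟧-⇔ (_ ≟ˢ T) (no (λ ()))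
             (λ eq → b≢ (trans (sym (insertAt-lookup (act σ S) j b)) (cong (λ R → lookup R j) eq))) ⊥-elim) ⟩
      ∑ᴾ {n} (λ _ → 0)
        ≡⟨ trans (∑ᴾ-const n 0) (ℕ.*-zeroʳ (n !)) ⟩
      0 ∎
    total : ∀ b → ∣ b ∷ S ∣ ≡ ∣ T ∣ →
      (∑[ j < suc n ] ⟦ b Bool.≟ lookup T j ⟧) * (∣ S ∣ ! * ∣ ∁ S ∣ !) ≡ ∣ b ∷ S ∣ ! * ∣ ∁ (b ∷ S) ∣ !
    total true eq = begin
      (∑[ j < suc n ] ⟦ true Bool.≟ lookup T j ⟧) * (∣ S ∣ ! * ∣ ∁ S ∣ !)  ≡⟨ cong (_* (∣ S ∣ ! * ∣ ∁ S ∣ !)) (trans (∑-lookup-true T) (sym eq)) ⟩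
      suc ∣ S ∣ * (∣ S ∣ ! * ∣ ∁ S ∣ !)   ≡⟨ ℕ.*-assoc (suc ∣ S ∣) (∣ S ∣ !) _ ⟨
      suc ∣ S ∣ ! * ∣ ∁ S ∣ !             ∎
    total false eq = begin
      (∑[ j < suc n ] ⟦ false Bool.≟ lookup T j ⟧) * (∣ S ∣ ! * ∣ ∁ S ∣ !)
        ≡⟨ cong (_* (∣ S ∣ ! * ∣ ∁ S ∣ !)) (trans (∑-lookup-false T) (trans (Sub.∣∁p∣≡n∸∣p∣ T)
             (trans (cong (suc n ∸_) (sym eq)) (sym (Sub.∣∁p∣≡n∸∣p∣ (false ∷ S)))))) ⟩
      suc ∣ ∁ S ∣ * (∣ S ∣ ! * ∣ ∁ S ∣ !)   ≡⟨ exchange (suc ∣ ∁ S ∣) (∣ S ∣ !) (∣ ∁ S ∣ !) ⟩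
      ∣ S ∣ ! * suc ∣ ∁ S ∣ !               ∎
      where
      exchange : ∀ a b c → a * (b * c) ≡ b * (a * c)
      exchange = ℕ-Solver.solve-∀

  ⊆⇒∣∩∣≡ : {S T : Subset n} → S ⊆ T → ∣ S ∩ T ∣ ≡ ∣ S ∣
  ⊆⇒∣∩∣≡ {S = S} {T} S⊆T = cong ∣_∣ (Sub.⊆-antisym (Sub.p∩q⊆p S T) (λ x∈S → Sub.x∈p∩q⁺ (x∈S , S⊆T x∈S)))

  ∣∩∣≢0⇒common : (S T : Subset n) → ∣ S ∩ T ∣ ≢ 0 → ∃ λ x → x ∈ S × x ∈ T
  ∣∩∣≢0⇒common {n} S T ≢0 with Sub.nonempty? (S ∩ T)
  ... | yes (x , x∈) = x , Sub.x∈p∩q⁻ S T x∈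
  ... | no empty = contradiction (trans (cong ∣_∣ (Sub.Empty-unique empty)) (Sub.∣⊥∣≡0 n)) ≢0

  ∣⁅x⁆∪S∣ : (x : Fin n) (S : Subset n) → x ∉ S → ∣ ⁅ x ⁆ ∪ S ∣ ≡ suc ∣ S ∣
  ∣⁅x⁆∪S∣ Fin.zero (true ∷ S) x∉S = contradiction Vec.here x∉S
  ∣⁅x⁆∪S∣ Fin.zero (false ∷ S) x∉S = cong suc (cong ∣_∣ (Sub.∪-identityˡ S))
  ∣⁅x⁆∪S∣ (Fin.suc x) (true ∷ S) x∉S = cong suc (∣⁅x⁆∪S∣ x S (x∉S ∘ Vec.there))
  ∣⁅x⁆∪S∣ (Fin.suc x) (false ∷ S) x∉S = ∣⁅x⁆∪S∣ x S (x∉S ∘ Vec.there)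

  -- Arcs on a cycle of length L

  module Cycle (M : ℕ) where

    L : ℕ
    L = suc M

    infix 4 _≈_
    _≈_ : ℕ → ℕ → Set
    x ≈ y = x % L ≡ y % L

    ≈-+ˡ : ∀ c x y → x ≈ y → c + x ≈ c + y
    ≈-+ˡ c x y x≈y = trans (%-distribˡ-+ c x L)
      (trans (cong (λ r → (c % L + r) % L) x≈y) (sym (%-distribˡ-+ c y L)))

    ≈-+ʳ : ∀ c x y → x ≈ y → x + c ≈ y + c
    ≈-+ʳ c x y x≈y = subst₂ _≈_ (ℕ.+-comm c x) (ℕ.+-comm c y) (≈-+ˡ c x y x≈y)

    -- To avoid subtraction, x and y are each shifted by the multiple of L that occurs in the
    -- division of the other sum; after that the two sides are equal as numbers.
    ≈-cancelˡ : ∀ c x y → c + x ≈ c + y → x ≈ y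
    ≈-cancelˡ c x y eq = begin
      x % L                         ≡⟨ [m+kn]%n≡m%n x ((c + y) / L) L ⟨
      (x + (c + y) / L * L) % L     ≡⟨ cong (_% L) (ℕ.+-cancelˡ-≡ (c + r) _ _ balanced) ⟩
      (y + (c + x) / L * L) % L     ≡⟨ [m+kn]%n≡m%n y ((c + x) / L) L ⟩
      y % L                         ∎
      where
      open ≡-Reasoning
      r = (c + x) % L
      qx = (c + x) / L * L
      qy = (c + y) / L * L
      rearrange : ∀ c r x q → (c + r) + (x + q) ≡ (c + x) + (r + q)
      rearrange = ℕ-Solver.solve-∀
      balanced : (c + r) + (x + qy) ≡ (c + r) + (y + qx)
      balanced = begin
        (c + r) + (x + qy)                  ≡⟨ rearrange c r x qy ⟩
        (c + x) + (r + qy)                  ≡⟨ cong (λ s → (c + x) + (s + qy)) eq ⟩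
        (c + x) + ((c + y) % L + qy)        ≡⟨ cong ((c + x) +_) (m≡m%n+[m/n]*n (c + y) L) ⟨
        (c + x) + (c + y)                   ≡⟨ cong (_+ (c + y)) (m≡m%n+[m/n]*n (c + x) L) ⟩
        (r + qx) + (c + y)                  ≡⟨ ℕ.+-comm (r + qx) (c + y) ⟩
        (c + y) + (r + qx)                  ≡⟨ rearrange c r y qx ⟨
        (c + r) + (y + qx)                  ∎

    ≈-cancelʳ : ∀ c x y → x + c ≈ y + c → x ≈ y
    ≈-cancelʳ c x y eq = ≈-cancelˡ c x y (subst₂ _≈_ (ℕ.+-comm x c) (ℕ.+-comm y c) eq)

    ≈⇒≡ : ∀ {x y} → x < L → y < L → x ≈ y → x ≡ y
    ≈⇒≡ x<L y<L eq = trans (sym (m<n⇒m%n≡m x<L)) (trans eq (m<n⇒m%n≡m y<L))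

    -- The start is any natural number, read modulo L, so wrapping around needs no case distinction.
    arc : ℕ → ℕ → Subset L
    arc x zero    = ∅
    arc x (suc s) = ⁅ x mod L ⁆ ∪ arc (suc x) s

    toℕ-mod : ∀ x → toℕ (x mod L) ≈ x
    toℕ-mod x = trans (cong (_% L) (Fin.toℕ-fromℕ< (m%n<n x L))) (m%n%n≡m%n x L)

    ∈-arc⁻ : ∀ x s {q} → q ∈ arc x s → ∃ λ y → y < s × x + y ≈ toℕ q
    ∈-arc⁻ x zero    q∈ = contradiction q∈ Sub.∉⊥
    ∈-arc⁻ x (suc s) q∈ with Sub.x∈p∪q⁻ ⁅ x mod L ⁆ (arc (suc x) s) q∈
    ... | inj₁ q∈⁅⁆ = 0 , s≤s z≤n , trans (cong (_% L) (ℕ.+-identityʳ x))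
      (trans (sym (toℕ-mod x)) (cong (λ q → toℕ q % L) (sym (Sub.x∈⁅y⁆⇒x≡y (x mod L) q∈⁅⁆))))
    ... | inj₂ q∈arc with ∈-arc⁻ (suc x) s q∈arc
    ...   | y , y<s , eq = suc y , s≤s y<s , trans (cong (_% L) (ℕ.+-suc x y)) eq

    ∈-arc⁺ : ∀ x s {q} y → y < s → x + y ≈ toℕ q → q ∈ arc x s
    ∈-arc⁺ x (suc s) {q} zero _ eq = Sub.x∈p∪q⁺ (inj₁ (subst (_∈ ⁅ x mod L ⁆)
      (Fin.toℕ-injective (≈⇒≡ (Fin.toℕ<n (x mod L)) (Fin.toℕ<n q)
        (trans (toℕ-mod x) (trans (cong (_% L) (sym (ℕ.+-identityʳ x))) eq)))) (Sub.x∈⁅x⁆ (x mod L))))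
    ∈-arc⁺ x (suc s) (suc y) (s≤s y<s) eq =
      Sub.x∈p∪q⁺ (inj₂ (∈-arc⁺ (suc x) s y y<s (trans (cong (_% L) (sym (ℕ.+-suc x y))) eq)))

    ∣arc∣ : ∀ x s → s ≤ L → ∣ arc x s ∣ ≡ s
    ∣arc∣ x zero    _   = Sub.∣⊥∣≡0 L
    ∣arc∣ x (suc s) s<L = trans (∣⁅x⁆∪S∣ (x mod L) (arc (suc x) s) new) (cong suc (∣arc∣ (suc x) s (ℕ.<⇒≤ s<L)))
      where
      new : x mod L ∉ arc (suc x) s
      new x∈ with ∈-arc⁻ (suc x) s x∈
      ... | y , y<s , eq with ≈⇒≡ (ℕ.≤-trans (s≤s y<s) s<L) (s≤s z≤n)
                                (≈-cancelˡ x (suc y) 0 (trans (cong (_% L) (ℕ.+-suc x y))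
                                  (trans eq (trans (toℕ-mod x) (cong (_% L) (sym (ℕ.+-identityʳ x)))))))
      ...   | ()

    arc-⊆ : ∀ x s x′ s′ u → x ≈ x′ + u → u + s ≤ s′ → arc x s ⊆ arc x′ s′
    arc-⊆ x s x′ s′ u eq le q∈ with ∈-arc⁻ x s q∈
    ... | y , y<s , eq′ = ∈-arc⁺ x′ s′ (u + y) (ℕ.<-≤-trans (ℕ.+-monoʳ-< u y<s) le)
      (trans (cong (_% L) (sym (ℕ.+-assoc x′ u y))) (trans (≈-+ʳ y (x′ + u) x (sym eq)) eq′))

    -- A common point would have two distances from x, one below s and one at least s. Both are
    -- below L, so they cannot agree modulo L.
    arc-adjacent : ∀ x s x′ s′ → x + s ≈ x′ → s + s′ ≤ L → ∀ {q} → q ∈ arc x s → q ∉ arc x′ s′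
    arc-adjacent x s x′ s′ eq le q∈ q∈′ with ∈-arc⁻ x s q∈ | ∈-arc⁻ x′ s′ q∈′
    ... | y , y<s , eq₁ | z , z<s′ , eq₂ = ℕ.<-irrefl y≡s+z (ℕ.<-≤-trans y<s (ℕ.m≤m+n s z))
      where
      s+z<L : s + z < L
      s+z<L = ℕ.<-≤-trans (ℕ.+-monoʳ-< s z<s′) le
      y≡s+z : y ≡ s + z
      y≡s+z = ≈⇒≡ (ℕ.<-trans (ℕ.<-≤-trans y<s (ℕ.m≤m+n s z)) s+z<L) s+z<L
        (≈-cancelˡ x y (s + z) (trans eq₁ (trans (sym eq₂)
          (trans (≈-+ʳ z x′ (x + s) (sym eq)) (cong (_% L) (ℕ.+-assoc x s z))))))

    -- The geometric core of the cycle method. The `s′` points x′ + c serve as cuts of the reference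
    -- arc: an arc that meets it without properly containing it must begin at a cut or have a cut as
    -- its first point beyond the end.
    arc-cut : ∀ x s x′ s′ {q} → q ∈ arc x s → q ∈ arc x′ s′ → (arc x′ s′ ⊆ arc x s → s ≤ s′) →
      ∃ λ c → c < s′ × (x ≈ x′ + c ⊎ x + s ≈ x′ + c)
    arc-cut x s x′ s′ q∈ q∈′ ⊆⇒≤ with ∈-arc⁻ x s q∈ | ∈-arc⁻ x′ s′ q∈′
    ... | y , y<s , eq₁ | z , z<s′ , eq₂ with ℕ.≤-total y z
    ...   | inj₁ y≤z = z ∸ y , ℕ.≤-<-trans (ℕ.m∸n≤m z y) z<s′ , inj₁ (≈-cancelʳ y x (x′ + (z ∸ y)) (begin
      (x + y) % L                ≡⟨ trans eq₁ (sym eq₂) ⟩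
      (x′ + z) % L               ≡⟨ cong (λ w → (x′ + w) % L) (ℕ.m∸n+n≡m y≤z) ⟨
      (x′ + (z ∸ y + y)) % L     ≡⟨ cong (_% L) (ℕ.+-assoc x′ (z ∸ y) y) ⟨
      (x′ + (z ∸ y) + y) % L     ∎))
      where open ≡-Reasoning
    ...   | inj₂ z≤y = split (s ∸ u ℕ.<? s′)
      where
      open ≡-Reasoning
      u = y ∸ z
      u≤s : u ≤ s
      u≤s = ℕ.≤-trans (ℕ.m∸n≤m y z) (ℕ.<⇒≤ y<s)
      x+u≈x′ : x + u ≈ x′
      x+u≈x′ = ≈-cancelʳ z (x + u) x′ (begin
        (x + u + z) % L      ≡⟨ cong (_% L) (trans (ℕ.+-assoc x u z) (cong (x +_) (ℕ.m∸n+n≡m z≤y))) ⟩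
        (x + y) % L          ≡⟨ trans eq₁ (sym eq₂) ⟩
        (x′ + z) % L         ∎)
      split : Dec (s ∸ u < s′) → _
      split (yes c<s′) = s ∸ u , c<s′ , inj₂ (begin
        (x + s) % L                ≡⟨ cong (λ w → (x + w) % L) (ℕ.m+[n∸m]≡n u≤s) ⟨
        (x + (u + (s ∸ u))) % L    ≡⟨ cong (_% L) (ℕ.+-assoc x u (s ∸ u)) ⟨
        (x + u + (s ∸ u)) % L      ≡⟨ ≈-+ʳ (s ∸ u) (x + u) x′ x+u≈x′ ⟩
        (x′ + (s ∸ u)) % L         ∎)
      -- The arc now starts u before x′ and reaches at least to the end of the reference arc, so it
      -- contains it. The hypothesis excludes proper containment, which leaves u ≡ 0 and the cut c =
      -- 0.
      split (no c≮s′) = 0 , ℕ.≤-<-trans z≤n z<s′ , inj₁ (begin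
        x % L          ≡⟨ cong (_% L) (trans (sym (ℕ.+-identityʳ x)) (cong (x +_) (sym u≡0))) ⟩
        (x + u) % L    ≡⟨ x+u≈x′ ⟩
        x′ % L         ≡⟨ cong (_% L) (ℕ.+-identityʳ x′) ⟨
        (x′ + 0) % L   ∎)
        where
        u+s′≤s : u + s′ ≤ s
        u+s′≤s = ℕ.≤-trans (ℕ.+-monoʳ-≤ u (ℕ.≮⇒≥ c≮s′)) (ℕ.≤-reflexive (ℕ.m+[n∸m]≡n u≤s))
        u≡0 : u ≡ 0
        u≡0 = ℕ.n≤0⇒n≡0 (ℕ.+-cancelʳ-≤ s′ u 0
          (ℕ.≤-trans u+s′≤s (⊆⇒≤ (arc-⊆ x′ s′ x s u (sym x+u≈x′) u+s′≤s))))

    module Family (T : Fin m → Subset L) (s : Fin m → ℕ)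
      (size : ∀ i → ∣ T i ∣ ≡ s i) (fits : ∀ i j → s i + s j ≤ L)
      (meets : ∀ i j → ∣ T i ∩ T j ∣ ≢ 0) (antichain : ∀ i j → i ≢ j → ∣ T i ∩ T j ∣ ≢ ∣ T i ∣)
      (mono : ∀ i j → i Fin.≤ j → s i ≤ s j) where

      Hit : Fin m → Fin L → Set
      Hit i p = T i ≡ arc (toℕ p) (s i)

      hit? : ∀ i p → Dec (Hit i p)
      hit? i p = T i ≟ˢ arc (toℕ p) (s i)

      nested⇒≡ : ∀ {i j p q} → Hit i p → Hit j q → arc (toℕ p) (s i) ⊆ arc (toℕ q) (s j) → i ≡ j
      nested⇒≡ {i} {j} hit hit′ sub = decidable-stable (i Fin.≟ j)
        (λ i≢j → antichain i j i≢j (⊆⇒∣∩∣≡ (subst₂ _⊆_ (sym hit) (sym hit′) sub)))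

      common : ∀ {i j p q} → Hit i p → Hit j q →
               ∃ λ z → z ∈ arc (toℕ p) (s i) × z ∈ arc (toℕ q) (s j)
      common {i} {j} hit hit′ with ∣∩∣≢0⇒common (T i) (T j) (meets i j)
      ... | z , z∈ , z∈′ = z , subst (z ∈_) hit z∈ , subst (z ∈_) hit′ z∈′

      start≡ : ∀ {i j p q} → Hit i p → Hit j q → toℕ p ≈ toℕ q → i ≡ j
      start≡ {i} {j} {p} {q} hit hit′ eq with ℕ.≤-total (s i) (s j)
      ... | inj₁ le = nested⇒≡ hit hit′ (arc-⊆ (toℕ p) (s i) (toℕ q) (s j) 0
        (trans eq (cong (_% L) (sym (ℕ.+-identityʳ (toℕ q))))) le)
      ... | inj₂ ge = sym (nested⇒≡ hit′ hit (arc-⊆ (toℕ q) (s j) (toℕ p) (s i) 0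
        (trans (sym eq) (cong (_% L) (sym (ℕ.+-identityʳ (toℕ p))))) ge))

      shorter-end : ∀ x y a b → x + a ≈ y + b → a ≤ b → arc x a ⊆ arc y b
      shorter-end x y a b eq a≤b = arc-⊆ x a y b (b ∸ a)
        (≈-cancelʳ a x (y + (b ∸ a)) (trans eq (cong (_% L)
          (trans (cong (y +_) (sym (ℕ.m∸n+n≡m a≤b))) (sym (ℕ.+-assoc y (b ∸ a) a))))))
        (ℕ.≤-reflexive (ℕ.m∸n+n≡m a≤b))

      end≡ : ∀ {i j p q} → Hit i p → Hit j q → toℕ p + s i ≈ toℕ q + s j → i ≡ j
      end≡ {i} {j} {p} {q} hit hit′ eq with ℕ.≤-total (s i) (s j)
      ... | inj₁ le = nested⇒≡ hit hit′ (shorter-end (toℕ p) (toℕ q) (s i) (s j) eq le)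
      ... | inj₂ ge = sym (nested⇒≡ hit′ hit (shorter-end (toℕ q) (toℕ p) (s j) (s i) (sym eq) ge))

      Cut : ℕ → Fin m → Fin L → Set
      Cut x i p = toℕ p ≈ x ⊎ toℕ p + s i ≈ x

      cut? : ∀ x i p → Dec (Cut x i p)
      cut? x i p = (toℕ p % L ℕ.≟ x % L) ⊎-dec ((toℕ p + s i) % L ℕ.≟ x % L)

      position≡ : ∀ {p q : Fin L} → toℕ p ≈ toℕ q → p ≡ q
      position≡ {p} {q} eq = Fin.toℕ-injective (≈⇒≡ (Fin.toℕ<n p) (Fin.toℕ<n q) eq)

      -- Arcs with a common start or a common end are nested, hence equal in an antichain. If one
      -- ends where the other starts, they are disjoint because together they fit into the cycle,
      -- and the family is intersecting.
      cut-unique : ∀ x {i j p q} → Hit i p × Cut x i p → Hit j q × Cut x j q → i ≡ j × p ≡ q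
      cut-unique x (hit , inj₁ c) (hit′ , inj₁ c′) =
        start≡ hit hit′ (trans c (sym c′)) , position≡ (trans c (sym c′))
      cut-unique x {i} {j} {p} {q} (hit , inj₂ c) (hit′ , inj₂ c′) with end≡ hit hit′ (trans c (sym c′))
      ... | refl = refl , position≡ (≈-cancelʳ (s i) (toℕ p) (toℕ q) (trans c (sym c′)))
      cut-unique x {i} {j} {p} {q} (hit , inj₁ c) (hit′ , inj₂ c′) with common hit hit′
      ... | z , z∈ , z∈′ = contradiction z∈
        (arc-adjacent (toℕ q) (s j) (toℕ p) (s i) (trans c′ (sym c)) (fits j i) z∈′)
      cut-unique x {i} {j} {p} {q} (hit , inj₂ c) (hit′ , inj₁ c′) with common hit hit′
      ... | z , z∈ , z∈′ = contradiction z∈′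
        (arc-adjacent (toℕ p) (s i) (toℕ q) (s j) (trans c (sym c′)) (fits i j) z∈)

      -- Every hit is charged to one of the `s i₀` cuts of the reference arc: `arc-cut` provides a
      -- cut, and `cut-unique` lets each cut be charged only once.
      hits≤ : ∀ {i₀ p₀} → Hit i₀ p₀ → (∀ i → ∃ (Hit i) → s i₀ ≤ s i) →
              ∑[ i < m ] ∑[ p < L ] ⟦ hit? i p ⟧ ≤ s i₀
      hits≤ {i₀} {p₀} hit₀ shortest = begin
        ∑[ i < m ] ∑[ p < L ] ⟦ hit? i p ⟧
          ≤⟨ sum-mono-≤ (λ i → sum-mono-≤ (classify i)) ⟩
        ∑[ i < m ] ∑[ p < L ] ∑[ c < s i₀ ] ⟦ class? c i p ⟧
          ≡⟨ sum-cong-≗ (λ i → ∑-comm (λ p c → ⟦ class? c i p ⟧)) ⟩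
        ∑[ i < m ] ∑[ c < s i₀ ] ∑[ p < L ] ⟦ class? c i p ⟧
          ≡⟨ ∑-comm (λ i c → ∑[ p < L ] ⟦ class? c i p ⟧) ⟩
        ∑[ c < s i₀ ] ∑[ i < m ] ∑[ p < L ] ⟦ class? c i p ⟧
          ≤⟨ sum-mono-≤ at-most-one ⟩
        ∑[ c < s i₀ ] 1
          ≡⟨ trans (sum-const (s i₀) 1) (ℕ.*-identityʳ (s i₀)) ⟩
        s i₀ ∎
        where
        open ℕ.≤-Reasoning
        x₀ = toℕ p₀
        class? : ∀ (c : Fin (s i₀)) i p → Dec (Hit i p × Cut (x₀ + toℕ c) i p)
        class? c i p = hit? i p ×-dec cut? (x₀ + toℕ c) i p
        term≤sum : ∀ {n} (f : Fin n → ℕ) i → f i ≤ sum f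
        term≤sum f Fin.zero    = ℕ.m≤m+n _ _
        term≤sum f (Fin.suc i) = ℕ.≤-trans (term≤sum (f ∘ Fin.suc) i) (ℕ.m≤n+m _ _)
        classify : ∀ i p → ⟦ hit? i p ⟧ ≤ ∑[ c < s i₀ ] ⟦ class? c i p ⟧
        classify i p with hit? i p in eq
        ... | no _ = z≤n
        ... | yes hit with common hit hit₀
        -- An arc of the family containing the reference arc belongs to the same member by the
        -- antichain condition, so the lengths agree.
        ...   | z , z∈ , z∈₀ with arc-cut (toℕ p) (s i) x₀ (s i₀) z∈ z∈₀
                  (λ sub → ℕ.≤-reflexive (cong s (sym (nested⇒≡ hit₀ hit sub))))
        ...     | c , c<s , cut = ℕ.≤-trans
          (ℕ.≤-reflexive (sym (⟦⟧-true (yes hit ×-dec cut? (x₀ + toℕ (fromℕ< c<s)) i p)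
            (hit , subst (λ c → Cut (x₀ + c) i p) (sym (Fin.toℕ-fromℕ< c<s)) cut))))
          (term≤sum (λ c → ⟦ yes hit ×-dec cut? (x₀ + toℕ c) i p ⟧) (fromℕ< c<s))
        at-most-one : ∀ c → ∑[ i < m ] ∑[ p < L ] ⟦ class? c i p ⟧ ≤ 1
        at-most-one c = sum≤1 (λ i → ∑[ p < L ] ⟦ class? c i p ⟧)
          (λ i → sum≤1 (λ p → ⟦ class? c i p ⟧) (λ p → ⟦⟧≤1 (class? c i p))
            (λ p q hp hq → proj₂ (cut-unique (x₀ + toℕ c) (⟦⟧>0⇒ (class? c i p) hp) (⟦⟧>0⇒ (class? c i q) hq))))
          (λ i j hi hj → let p , hp = sum>0⇒ (λ p → ⟦ class? c i p ⟧) hi ; q , hq = sum>0⇒ (λ q → ⟦ class? c j q ⟧) hj in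
            proj₁ (cut-unique (x₀ + toℕ c) (⟦⟧>0⇒ (class? c i p) hp) (⟦⟧>0⇒ (class? c j q) hq)))

      s≢0 : ∀ i → s i ≢ 0
      s≢0 i si≡0 = meets i i (trans (cong ∣_∣ (Sub.∩-idem (T i))) (trans (size i) si≡0))

      -- Weights inversely proportional to the sizes handle members of different size. The first
      -- index with a hit has, by `mono`, the shortest arc among the hits and hence the largest
      -- weight, and `s i₀` hits of weight at most `w i₀` amount to at most D.
      weighted-hits≤ : ∀ (w : Fin m → ℕ) D → (∀ i → w i * s i ≡ D) →
                       ∑[ i < m ] ∑[ p < L ] (⟦ hit? i p ⟧ * w i) ≤ D
      weighted-hits≤ w D w*s≡D with least (λ i → Fin.any? (hit? i))
      ... | inj₁ none = ℕ.≤-trans (ℕ.≤-reflexive (trans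
        (sum-cong-≗ (λ i → trans (sum-cong-≗ (λ p → cong (_* w i) (⟦⟧-⇔ (hit? i p) (no (λ ())) (λ h → none i (p , h)) ⊥-elim)))
          (sum-replicate-zero L))) (sum-replicate-zero m))) z≤n
      ... | inj₂ (i₀ , (p₀ , hit₀) , first) = begin
        ∑[ i < m ] ∑[ p < L ] (⟦ hit? i p ⟧ * w i)
          ≤⟨ sum-mono-≤ (λ i → sum-mono-≤ (heaviest i)) ⟩
        ∑[ i < m ] ∑[ p < L ] (⟦ hit? i p ⟧ * w i₀)
          ≡⟨ sum-cong-≗ (λ i → *-distribʳ-sum (w i₀) (λ p → ⟦ hit? i p ⟧)) ⟨
        ∑[ i < m ] ((∑[ p < L ] ⟦ hit? i p ⟧) * w i₀)
          ≡⟨ *-distribʳ-sum (w i₀) (λ i → ∑[ p < L ] ⟦ hit? i p ⟧) ⟨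
        (∑[ i < m ] ∑[ p < L ] ⟦ hit? i p ⟧) * w i₀
          ≤⟨ ℕ.*-monoˡ-≤ (w i₀) (hits≤ hit₀ shortest) ⟩
        s i₀ * w i₀
          ≡⟨ trans (ℕ.*-comm (s i₀) (w i₀)) (w*s≡D i₀) ⟩
        D ∎
        where
        open ℕ.≤-Reasoning
        shortest : ∀ i → ∃ (Hit i) → s i₀ ≤ s i
        shortest i hit = mono i₀ i (first i hit)
        heaviest : ∀ i p → ⟦ hit? i p ⟧ * w i ≤ ⟦ hit? i p ⟧ * w i₀
        heaviest i p with hit? i p
        ... | no _ = z≤n
        ... | yes hit = ℕ.*-monoʳ-≤ 1 (ℕ.*-cancelʳ-≤ (w i) (w i₀) (s i) {{ℕ.≢-nonZero (s≢0 i)}} (begin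
          w i * s i       ≡⟨ trans (w*s≡D i) (sym (w*s≡D i₀)) ⟩
          w i₀ * s i₀     ≤⟨ ℕ.*-monoʳ-≤ (w i₀) (shortest i (p , hit)) ⟩
          w i₀ * s i      ∎))

  -- Katona's cycle method: double counting of the pairs of a permutation and an
  -- arc which is the image of a member of the family.
  greene-katona-kleitman : ∀ {M} (S : Fin m → Subset (suc M)) (k : Fin m → ℕ) →
    (∀ i → ∣ S i ∣ ≡ suc (k i)) → (∀ i → suc (k i) + suc (k i) ≤ suc M) →
    (∀ i j → ∣ S i ∩ S j ∣ ≢ 0) → (∀ i j → i ≢ j → ∣ S i ∩ S j ∣ ≢ ∣ S i ∣) →
    (∀ i j → i Fin.≤ j → k i ≤ k j) →
    ∑[ i < m ] (k i ! * (M ∸ k i) !) ≤ M !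
  greene-katona-kleitman {m} {M} S k size half meets antichain mono =
    -- For each of the L arcs of length s i there are s! (L - s)! permutations carrying S i to it,
    -- each counted with weight D / s. With s = k + 1 and L = M + 1 this gives L · D times the
    -- summand k! (M - k)!.
    ℕ.*-cancelˡ-≤ (L * D) {{ℕ.m*n≢0 L D {{_}} {{L ℕ.!≢0}}}} (begin
      (L * D) * ∑[ i < m ] (k i ! * (M ∸ k i) !)
        ≡⟨ *-distribˡ-sum (L * D) (λ i → k i ! * (M ∸ k i) !) ⟩
      ∑[ i < m ] (L * D * (k i ! * (M ∸ k i) !))
        ≡⟨ sum-cong-≗ (λ i → sym (images i)) ⟩
      ∑[ i < m ] ∑ᴾ (λ σ → ∑[ p < L ] (⟦ act σ (S i) ≟ˢ arc (toℕ p) (s i) ⟧ * w i))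
        ≡⟨ ∑ᴾ-∑ (λ i σ → ∑[ p < L ] (⟦ act σ (S i) ≟ˢ arc (toℕ p) (s i) ⟧ * w i)) ⟨
      ∑ᴾ (λ σ → ∑[ i < m ] ∑[ p < L ] (⟦ act σ (S i) ≟ˢ arc (toℕ p) (s i) ⟧ * w i))
        ≤⟨ ∑ᴾ-mono-≤ per-cycle ⟩
      ∑ᴾ {L} (λ _ → D)
        ≡⟨ ∑ᴾ-const L D ⟩
      D * D
        ≡⟨ rotate L (M !) D ⟩
      (L * D) * M ! ∎)
    where
    open Cycle M
    open ℕ.≤-Reasoning
    s : Fin m → ℕ
    s i = suc (k i)
    -- L! is divisible by every size up to L, so the weights are natural numbers; it is also the
    -- number of permutations.
    D = L !
    w : Fin m → ℕ
    w i = D / s i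
    s≤L : ∀ i → s i ≤ L
    s≤L i = ℕ.≤-trans (ℕ.m≤m+n (s i) (s i)) (half i)
    w*s≡D : ∀ i → w i * s i ≡ D
    w*s≡D i = m/n*n≡m (∣-trans (m∣m*n (k i !)) (m≤n⇒m!∣n! (s≤L i)))
    rotate : ∀ l f d → (l * f) * d ≡ (l * d) * f
    rotate = ℕ-Solver.solve-∀
    fits : ∀ i j → s i + s j ≤ L
    fits i j with ℕ.≤-total (s i) (s j)
    ... | inj₁ le = ℕ.≤-trans (ℕ.+-monoˡ-≤ (s j) le) (half j)
    ... | inj₂ ge = ℕ.≤-trans (ℕ.+-monoʳ-≤ (s i) ge) (half i)
    per-cycle : ∀ σ → ∑[ i < m ] ∑[ p < L ] (⟦ act σ (S i) ≟ˢ arc (toℕ p) (s i) ⟧ * w i) ≤ D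
    per-cycle σ = Family.weighted-hits≤ (λ i → act σ (S i)) s
      (λ i → trans (∣act∣ σ (S i)) (size i)) fits
      (λ i j → meets i j ∘ trans (sym (∣act∩act∣ σ (S i) (S j))))
      (λ i j i≢j eq → antichain i j i≢j (trans (sym (∣act∩act∣ σ (S i) (S j))) (trans eq (∣act∣ σ (S i)))))
      (λ i j i≤j → s≤s (mono i j i≤j)) w D w*s≡D
    collect : ∀ l f k! r w → l * (((f * k!) * r) * w) ≡ l * (w * f) * (k! * r)
    collect = ℕ-Solver.solve-∀
    images : ∀ i → ∑ᴾ (λ σ → ∑[ p < L ] (⟦ act σ (S i) ≟ˢ arc (toℕ p) (s i) ⟧ * w i)) ≡
                   L * D * (k i ! * (M ∸ k i) !)
    images i = begin-equality
      ∑ᴾ (λ σ → ∑[ p < L ] (⟦ act σ (S i) ≟ˢ arc (toℕ p) (s i) ⟧ * w i))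
        ≡⟨ ∑ᴾ-∑ {L} (λ p σ → ⟦ act σ (S i) ≟ˢ arc (toℕ p) (s i) ⟧ * w i) ⟩
      ∑[ p < L ] ∑ᴾ (λ σ → ⟦ act σ (S i) ≟ˢ arc (toℕ p) (s i) ⟧ * w i)
        ≡⟨ sum-cong-≗ {L} (λ p → trans (∑ᴾ-*ʳ (λ σ → ⟦ act σ (S i) ≟ˢ arc (toℕ p) (s i) ⟧) (w i))
             (cong (_* w i) (count-permutations (S i) (arc (toℕ p) (s i))
               (trans (size i) (sym (∣arc∣ (toℕ p) (s i) (s≤L i))))))) ⟩
      ∑[ p < L ] (∣ S i ∣ ! * ∣ ∁ (S i) ∣ ! * w i)
        ≡⟨ sum-const L _ ⟩
      L * (∣ S i ∣ ! * ∣ ∁ (S i) ∣ ! * w i)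
        ≡⟨ cong₂ (λ a b → L * (a ! * b ! * w i)) (size i) (trans (Sub.∣∁p∣≡n∸∣p∣ (S i)) (cong (L ∸_) (size i))) ⟩
      L * ((s i * k i !) * (M ∸ k i) ! * w i)
        ≡⟨ collect L (s i) (k i !) ((M ∸ k i) !) (w i) ⟩
      L * (w i * s i) * (k i ! * (M ∸ k i) !)
        ≡⟨ cong (λ d → L * d * (k i ! * (M ∸ k i) !)) (w*s≡D i) ⟩
      L * D * (k i ! * (M ∸ k i) !) ∎

open CycleMethod using (greene-katona-kleitman)

-- Sums of reciprocals

open import Data.Integer using (+_)
open import Data.Rational using (_/_)
open import Algebra.Properties.Monoid.Sum +-0-monoid using (sum-syntax)
open import Data.Nat.DivMod using (m/n*n≡m)

private variable
  n m k t : ℕ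

-- Unnormalised rationals keep the common denominator `suc D` (stored as D), so that in a sum only
-- the numerators have to be added.
reciprocal-≃ : ∀ c x D .{{_ : NonZero c}} → c * x ≡ suc D → toℚᵘ ((+ 1) / c) ℚᵘ.≃ mkℚᵘ (+ x) D
reciprocal-≃ c@(suc c-1) x D cx≡D = ℚᵘ.≃-trans (ℚ.toℚᵘ-fromℚᵘ (mkℚᵘ (+ 1) c-1)) (*≡* (begin
  (+ 1) ℤ.* (+ suc D)    ≡⟨ ℤ.*-identityˡ (+ suc D) ⟩
  + suc D                ≡⟨ cong +_ (trans (sym cx≡D) (ℕ.*-comm c x)) ⟩
  + (x * c)              ≡⟨ ℤ.pos-* x c ⟩
  (+ x) ℤ.* (+ c)        ∎))
  where open ≡-Reasoning

∑-reciprocals-≃ : ∀ (c x : Fin m → ℕ) .(c≢0 : ∀ i → NonZero (c i)) D → (∀ i → c i * x i ≡ suc D) →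
  toℚᵘ (∑[ i < m ] (_/_ (+ 1) (c i) {{c≢0 i}})) ℚᵘ.≃ mkℚᵘ (+ ∑ℕ.sum x) D
∑-reciprocals-≃ {zero} c x c≢0 D cx≡D = *≡* refl
∑-reciprocals-≃ {suc m} c x c≢0 D cx≡D = begin
  toℚᵘ (r ℚ.+ rs)                         ≈⟨ ℚ.toℚᵘ-homo-+ r rs ⟩
  toℚᵘ r ℚᵘ.+ toℚᵘ rs                     ≈⟨ ℚᵘ.+-cong
    (reciprocal-≃ (c Fin.zero) (x Fin.zero) D {{c≢0 Fin.zero}} (cx≡D Fin.zero))
    (∑-reciprocals-≃ (λ i → c (Fin.suc i)) (λ i → x (Fin.suc i)) (λ i → c≢0 (Fin.suc i)) D (λ i → cx≡D (Fin.suc i))) ⟩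
  mkℚᵘ (+ x₀) D ℚᵘ.+ mkℚᵘ (+ xs) D        ≈⟨ *≡* (common-denominator (+ x₀) (+ xs) (+ suc D)) ⟩
  mkℚᵘ (+ (x₀ + xs)) D                    ∎
  where
  open import Relation.Binary.Reasoning.Setoid ℚᵘ.≃-setoid
  r = _/_ (+ 1) (c Fin.zero) {{c≢0 Fin.zero}}
  rs = ∑[ i < m ] (_/_ (+ 1) (c (Fin.suc i)) {{c≢0 (Fin.suc i)}})
  x₀ = x Fin.zero
  xs = ∑ℕ.sum (λ i → x (Fin.suc i))
  common-denominator : ∀ a b d → (a ℤ.* d ℤ.+ b ℤ.* d) ℤ.* d ≡ (a ℤ.+ b) ℤ.* (d ℤ.* d)
  common-denominator = ℤ-Solver.solve-∀

∑-reciprocals≤1 : ∀ (c x : Fin m → ℕ) .(c≢0 : ∀ i → NonZero (c i)) D .{{_ : NonZero D}} →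
  (∀ i → c i * x i ≡ D) → ∑ℕ.sum x ≤ D → (∑[ i < m ] (_/_ (+ 1) (c i) {{c≢0 i}})) ℚ.≤ 1ℚ
∑-reciprocals≤1 c x c≢0 (suc D) cx≡D ∑x≤D = ℚ.toℚᵘ-cancel-≤ (ℚᵘ.≤-respˡ-≃
  (ℚᵘ.≃-sym (∑-reciprocals-≃ c x c≢0 D cx≡D))
  (*≤* (subst₂ ℤ._≤_ (sym (ℤ.*-identityʳ _)) (sym (ℤ.*-identityˡ _)) (ℤ.+≤+ ∑x≤D))))

nCk*k![n∸k]!≡n! : ∀ {n k} → k ≤ n → (n C k) * (k ! * (n ∸ k) !) ≡ n !
nCk*k![n∸k]!≡n! {n} {k} k≤n = trans (cong (_* (k ! * (n ∸ k) !)) (nCk≡n!/k![n-k]! k≤n))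
  (m/n*n≡m (k![n∸k]!∣n! k≤n))
  where instance _ = k ℕ.!* (n ∸ k) !≢0

-- The exterior algebra over ℤ

open ≡-Reasoning

infixl 6 _⊕_
infixl 7 _⊗_
infixr 8 _•_
infix 9 ⊖_
infix 5 _⊹_

-- f ⊹ g is f + x ∧ g with x the first generator, and bar is the grading involution.
data E : ℕ → Set where
  scalar : ℤ → E 0
  _⊹_    : E n → E n → E (suc n)

scalar-injective : ∀ {a b} → scalar a ≡ scalar b → a ≡ b
scalar-injective refl = refl

⊹-injectiveˡ : ∀ {f g f′ g′ : E n} → f ⊹ g ≡ f′ ⊹ g′ → f ≡ f′
⊹-injectiveˡ refl = refl

⊹-injectiveʳ : ∀ {f g f′ g′ : E n} → f ⊹ g ≡ f′ ⊹ g′ → g ≡ g′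
⊹-injectiveʳ refl = refl

constant : ℤ → E n
constant {zero}  c = scalar c
constant {suc n} c = constant c ⊹ constant 0ℤ

0ᴱ 1ᴱ : E n
0ᴱ = constant 0ℤ
1ᴱ = constant 1ℤ

_⊕_ : E n → E n → E n
scalar a  ⊕ scalar b    = scalar (a ℤ.+ b)
(f₀ ⊹ f₁) ⊕ (g₀ ⊹ g₁) = f₀ ⊕ g₀ ⊹ f₁ ⊕ g₁

⊖_ : E n → E n
⊖ scalar a    = scalar (ℤ.- a)
⊖ (f₀ ⊹ f₁) = ⊖ f₀ ⊹ ⊖ f₁

_•_ : ℤ → E n → E n
c • scalar a    = scalar (c ℤ.* a)
c • (f₀ ⊹ f₁) = c • f₀ ⊹ c • f₁

bar : E n → E n
bar (scalar a)  = scalar a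
bar (f₀ ⊹ f₁) = bar f₀ ⊹ ⊖ bar f₁

-- With x the first generator, f₀ ∧ x ∧ g₁ = x ∧ bar f₀ ∧ g₁, which explains the twist; the product
-- of the two terms containing x is zero.
_⊗_ : E n → E n → E n
scalar a  ⊗ scalar b    = scalar (a ℤ.* b)
(f₀ ⊹ f₁) ⊗ (g₀ ⊹ g₁) = f₀ ⊗ g₀ ⊹ f₁ ⊗ g₀ ⊕ bar f₀ ⊗ g₁

⊕-assoc : (f g h : E n) → (f ⊕ g) ⊕ h ≡ f ⊕ (g ⊕ h)
⊕-assoc (scalar a) (scalar b) (scalar c) = cong scalar (ℤ.+-assoc a b c)
⊕-assoc (f ⊹ f′) (g ⊹ g′) (h ⊹ h′) = cong₂ _⊹_ (⊕-assoc f g h) (⊕-assoc f′ g′ h′)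

⊕-comm : (f g : E n) → f ⊕ g ≡ g ⊕ f
⊕-comm (scalar a) (scalar b) = cong scalar (ℤ.+-comm a b)
⊕-comm (f ⊹ f′) (g ⊹ g′) = cong₂ _⊹_ (⊕-comm f g) (⊕-comm f′ g′)

⊕-identityˡ : (f : E n) → 0ᴱ ⊕ f ≡ f
⊕-identityˡ (scalar a) = cong scalar (ℤ.+-identityˡ a)
⊕-identityˡ (f ⊹ f′) = cong₂ _⊹_ (⊕-identityˡ f) (⊕-identityˡ f′)

⊕-identityʳ : (f : E n) → f ⊕ 0ᴱ ≡ f
⊕-identityʳ f = trans (⊕-comm f 0ᴱ) (⊕-identityˡ f)

⊖-inverseˡ : (f : E n) → ⊖ f ⊕ f ≡ 0ᴱ
⊖-inverseˡ (scalar a) = cong scalar (ℤ.+-inverseˡ a)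
⊖-inverseˡ (f ⊹ f′) = cong₂ _⊹_ (⊖-inverseˡ f) (⊖-inverseˡ f′)

⊖-inverseʳ : (f : E n) → f ⊕ ⊖ f ≡ 0ᴱ
⊖-inverseʳ f = trans (⊕-comm f (⊖ f)) (⊖-inverseˡ f)

⊕-isAbelianGroup : IsAbelianGroup (_≡_ {A = E n}) _⊕_ 0ᴱ ⊖_
⊕-isAbelianGroup = record
  { isGroup = record
    { isMonoid = record
      { isSemigroup = record
        { isMagma = record { isEquivalence = isEquivalence ; ∙-cong = cong₂ _⊕_ }
        ; assoc = ⊕-assoc }
      ; identity = ⊕-identityˡ , ⊕-identityʳ }
    ; inverse = ⊖-inverseˡ , ⊖-inverseʳ
    ; ⁻¹-cong = cong ⊖_ }
  ; comm = ⊕-comm }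

⊕-abelianGroup : ℕ → AbelianGroup _ _
⊕-abelianGroup n = record { isAbelianGroup = ⊕-isAbelianGroup {n} }

module _ {n : ℕ} where
  open AbelianGroup (⊕-abelianGroup n) using (commutativeSemigroup)
  open import Algebra.Properties.CommutativeSemigroup commutativeSemigroup public
    using () renaming (interchange to ⊕-interchange)
  open import Algebra.Properties.AbelianGroup (⊕-abelianGroup n) public
    using () renaming (⁻¹-involutive to ⊖-involutive; ⁻¹-∙-comm to ⊖-⊕; ε⁻¹≈ε to ⊖-0ᴱ)

bar-⊖ : (f : E n) → bar (⊖ f) ≡ ⊖ bar f
bar-⊖ (scalar a) = refl
bar-⊖ (f ⊹ g) = cong₂ _⊹_ (bar-⊖ f) (cong ⊖_ (bar-⊖ g))

bar-⊕ : (f g : E n) → bar (f ⊕ g) ≡ bar f ⊕ bar g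
bar-⊕ (scalar a) (scalar b) = refl
bar-⊕ (f ⊹ f′) (g ⊹ g′) =
  cong₂ _⊹_ (bar-⊕ f g) (trans (cong ⊖_ (bar-⊕ f′ g′)) (sym (⊖-⊕ (bar f′) (bar g′))))

bar-involutive : (f : E n) → bar (bar f) ≡ f
bar-involutive (scalar a) = refl
bar-involutive (f ⊹ g) = cong₂ _⊹_ (bar-involutive f)
  (trans (cong ⊖_ (bar-⊖ (bar g))) (trans (⊖-involutive (bar (bar g))) (bar-involutive g)))

bar-constant : (c : ℤ) → bar (constant {n} c) ≡ constant c
bar-constant {zero}  c = refl
bar-constant {suc n} c =
  cong₂ _⊹_ (bar-constant c) (trans (cong ⊖_ (bar-constant 0ℤ)) ⊖-0ᴱ)

⊗-distribʳ : (h f g : E n) → (f ⊕ g) ⊗ h ≡ f ⊗ h ⊕ g ⊗ h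
⊗-distribʳ (scalar a) (scalar b) (scalar c) = cong scalar (ℤ.*-distribʳ-+ a b c)
⊗-distribʳ (h ⊹ h′) (f ⊹ f′) (g ⊹ g′) = cong₂ _⊹_ (⊗-distribʳ h f g)
  (trans (cong₂ _⊕_ (⊗-distribʳ h f′ g′)
                    (trans (cong (_⊗ h′) (bar-⊕ f g)) (⊗-distribʳ h′ (bar f) (bar g))))
         (⊕-interchange _ _ _ _))

⊗-distribˡ : (h f g : E n) → h ⊗ (f ⊕ g) ≡ h ⊗ f ⊕ h ⊗ g
⊗-distribˡ (scalar a) (scalar b) (scalar c) = cong scalar (ℤ.*-distribˡ-+ a b c)
⊗-distribˡ (h ⊹ h′) (f ⊹ f′) (g ⊹ g′) = cong₂ _⊹_ (⊗-distribˡ h f g)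
  (trans (cong₂ _⊕_ (⊗-distribˡ h′ f g) (⊗-distribˡ (bar h) f′ g′)) (⊕-interchange _ _ _ _))

⊖-⊗ : (f g : E n) → ⊖ f ⊗ g ≡ ⊖ (f ⊗ g)
⊖-⊗ (scalar a) (scalar b) = cong scalar (sym (ℤ.neg-distribˡ-* a b))
⊖-⊗ (f ⊹ f′) (g ⊹ g′) = cong₂ _⊹_ (⊖-⊗ f g)
  (trans (cong₂ _⊕_ (⊖-⊗ f′ g) (trans (cong (_⊗ g′) (bar-⊖ f)) (⊖-⊗ (bar f) g′)))
         (⊖-⊕ (f′ ⊗ g) (bar f ⊗ g′)))

⊗-⊖ : (f g : E n) → f ⊗ ⊖ g ≡ ⊖ (f ⊗ g)
⊗-⊖ (scalar a) (scalar b) = cong scalar (sym (ℤ.neg-distribʳ-* a b))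
⊗-⊖ (f ⊹ f′) (g ⊹ g′) = cong₂ _⊹_ (⊗-⊖ f g)
  (trans (cong₂ _⊕_ (⊗-⊖ f′ g) (⊗-⊖ (bar f) g′)) (⊖-⊕ (f′ ⊗ g) (bar f ⊗ g′)))

bar-⊗ : (f g : E n) → bar (f ⊗ g) ≡ bar f ⊗ bar g
bar-⊗ (scalar a) (scalar b) = refl
bar-⊗ (f ⊹ f′) (g ⊹ g′) = cong₂ _⊹_ (bar-⊗ f g) (begin
  ⊖ bar (f′ ⊗ g ⊕ bar f ⊗ g′)                     ≡⟨ cong ⊖_ (bar-⊕ (f′ ⊗ g) (bar f ⊗ g′)) ⟩
  ⊖ (bar (f′ ⊗ g) ⊕ bar (bar f ⊗ g′))             ≡⟨ cong ⊖_ (cong₂ _⊕_ (bar-⊗ f′ g) (bar-⊗ (bar f) g′)) ⟩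
  ⊖ (bar f′ ⊗ bar g ⊕ bar (bar f) ⊗ bar g′)       ≡⟨ ⊖-⊕ _ _ ⟨
  ⊖ (bar f′ ⊗ bar g) ⊕ ⊖ (bar (bar f) ⊗ bar g′)   ≡⟨ cong₂ _⊕_ (⊖-⊗ _ _) (⊗-⊖ _ _) ⟨
  ⊖ bar f′ ⊗ bar g ⊕ bar (bar f) ⊗ ⊖ bar g′       ∎)

⊗-assoc : (f g h : E n) → (f ⊗ g) ⊗ h ≡ f ⊗ (g ⊗ h)
⊗-assoc (scalar a) (scalar b) (scalar c) = cong scalar (ℤ.*-assoc a b c)
⊗-assoc (f ⊹ f′) (g ⊹ g′) (h ⊹ h′) = cong₂ _⊹_ (⊗-assoc f g h) (begin
  (f′ ⊗ g ⊕ bar f ⊗ g′) ⊗ h ⊕ bar (f ⊗ g) ⊗ h′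
    ≡⟨ cong₂ _⊕_ (⊗-distribʳ h (f′ ⊗ g) (bar f ⊗ g′)) (cong (_⊗ h′) (bar-⊗ f g)) ⟩
  ((f′ ⊗ g) ⊗ h ⊕ (bar f ⊗ g′) ⊗ h) ⊕ (bar f ⊗ bar g) ⊗ h′
    ≡⟨ cong₂ _⊕_ (cong₂ _⊕_ (⊗-assoc f′ g h) (⊗-assoc (bar f) g′ h)) (⊗-assoc (bar f) (bar g) h′) ⟩
  (f′ ⊗ (g ⊗ h) ⊕ bar f ⊗ (g′ ⊗ h)) ⊕ bar f ⊗ (bar g ⊗ h′)
    ≡⟨ ⊕-assoc _ _ _ ⟩
  f′ ⊗ (g ⊗ h) ⊕ (bar f ⊗ (g′ ⊗ h) ⊕ bar f ⊗ (bar g ⊗ h′))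
    ≡⟨ cong (f′ ⊗ (g ⊗ h) ⊕_) (⊗-distribˡ (bar f) _ _) ⟨
  f′ ⊗ (g ⊗ h) ⊕ bar f ⊗ (g′ ⊗ h ⊕ bar g ⊗ h′)   ∎)

•-⊕ : (c : ℤ) (f g : E n) → c • (f ⊕ g) ≡ c • f ⊕ c • g
•-⊕ c (scalar a) (scalar b) = cong scalar (ℤ.*-distribˡ-+ c a b)
•-⊕ c (f ⊹ f′) (g ⊹ g′) = cong₂ _⊹_ (•-⊕ c f g) (•-⊕ c f′ g′)

+-• : (c d : ℤ) (f : E n) → (c ℤ.+ d) • f ≡ c • f ⊕ d • f
+-• c d (scalar a) = cong scalar (ℤ.*-distribʳ-+ a c d)
+-• c d (f ⊹ g) = cong₂ _⊹_ (+-• c d f) (+-• c d g)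

*-• : (c d : ℤ) (f : E n) → (c ℤ.* d) • f ≡ c • d • f
*-• c d (scalar a) = cong scalar (ℤ.*-assoc c d a)
*-• c d (f ⊹ g) = cong₂ _⊹_ (*-• c d f) (*-• c d g)

•-comm : (c d : ℤ) (f : E n) → c • d • f ≡ d • c • f
•-comm c d f = trans (sym (*-• c d f)) (trans (cong (_• f) (ℤ.*-comm c d)) (*-• d c f))

0• : (f : E n) → 0ℤ • f ≡ 0ᴱ
0• (scalar a) = cong scalar (ℤ.*-zeroˡ a)
0• (f ⊹ g) = cong₂ _⊹_ (0• f) (0• g)

1• : (f : E n) → 1ℤ • f ≡ f
1• (scalar a) = cong scalar (ℤ.*-identityˡ a)
1• (f ⊹ g) = cong₂ _⊹_ (1• f) (1• g)

-1• : (f : E n) → ℤ.-1ℤ • f ≡ ⊖ f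
-1• (scalar a) = cong scalar (ℤ.-1*i≡-i a)
-1• (f ⊹ g) = cong₂ _⊹_ (-1• f) (-1• g)

•-0ᴱ : (c : ℤ) → c • 0ᴱ {n} ≡ 0ᴱ
•-0ᴱ {zero}  c = cong scalar (ℤ.*-zeroʳ c)
•-0ᴱ {suc n} c = cong₂ _⊹_ (•-0ᴱ c) (•-0ᴱ c)

-- The substitute for division: multipliers gathered during elimination and reduction are removed by
-- it.
•-torsionFree : {c : ℤ} (f : E n) → c ≢ 0ℤ → c • f ≡ 0ᴱ → f ≡ 0ᴱ
•-torsionFree {c = c} (scalar a) c≢0 eq with ℤ.i*j≡0⇒i≡0∨j≡0 c (scalar-injective eq)
... | inj₁ c≡0 = contradiction c≡0 c≢0
... | inj₂ a≡0 = cong scalar a≡0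
•-torsionFree (f ⊹ g) c≢0 eq = cong₂ _⊹_
  (•-torsionFree f c≢0 (⊹-injectiveˡ eq)) (•-torsionFree g c≢0 (⊹-injectiveʳ eq))

bar-• : (c : ℤ) (f : E n) → bar (c • f) ≡ c • bar f
bar-• c (scalar a) = refl
bar-• c (f ⊹ g) = cong₂ _⊹_ (bar-• c f) (trans (cong ⊖_ (bar-• c g)) (⊖-• c (bar g)))
  where
  ⊖-• : (c : ℤ) (f : E n) → ⊖ (c • f) ≡ c • ⊖ f
  ⊖-• c f = trans (sym (-1• (c • f))) (trans (•-comm _ c f) (cong (c •_) (-1• f)))

•-⊗ : (c : ℤ) (f g : E n) → (c • f) ⊗ g ≡ c • (f ⊗ g)
•-⊗ c (scalar a) (scalar b) = cong scalar (ℤ.*-assoc c a b)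
•-⊗ c (f ⊹ f′) (g ⊹ g′) = cong₂ _⊹_ (•-⊗ c f g)
  (trans (cong₂ _⊕_ (•-⊗ c f′ g) (trans (cong (_⊗ g′) (bar-• c f)) (•-⊗ c (bar f) g′)))
         (sym (•-⊕ c _ _)))

⊗-• : (c : ℤ) (f g : E n) → f ⊗ (c • g) ≡ c • (f ⊗ g)
⊗-• c (scalar a) (scalar b) = cong scalar
  (trans (sym (ℤ.*-assoc a c b)) (trans (cong (ℤ._* b) (ℤ.*-comm a c)) (ℤ.*-assoc c a b)))
⊗-• c (f ⊹ f′) (g ⊹ g′) = cong₂ _⊹_ (⊗-• c f g)
  (trans (cong₂ _⊕_ (⊗-• c f′ g) (⊗-• c (bar f) g′)) (sym (•-⊕ c _ _)))

⊗-zeroˡ : (f : E n) → 0ᴱ ⊗ f ≡ 0ᴱ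
⊗-zeroˡ f = trans (cong (_⊗ f) (sym (0• f))) (trans (•-⊗ 0ℤ f f) (0• (f ⊗ f)))

⊗-zeroʳ : (f : E n) → f ⊗ 0ᴱ ≡ 0ᴱ
⊗-zeroʳ f = trans (cong (f ⊗_) (sym (0• f))) (trans (⊗-• 0ℤ f f) (0• (f ⊗ f)))

⊗-identityˡ : (f : E n) → 1ᴱ ⊗ f ≡ f
⊗-identityˡ (scalar a) = cong scalar (ℤ.*-identityˡ a)
⊗-identityˡ (f ⊹ g) = cong₂ _⊹_ (⊗-identityˡ f)
  (trans (cong₂ _⊕_ (⊗-zeroˡ f) (trans (cong (_⊗ g) (bar-constant 1ℤ)) (⊗-identityˡ g)))
         (⊕-identityˡ g))

⊗-identityʳ : (f : E n) → f ⊗ 1ᴱ ≡ f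
⊗-identityʳ (scalar a) = cong scalar (ℤ.*-identityʳ a)
⊗-identityʳ (f ⊹ g) = cong₂ _⊹_ (⊗-identityʳ f)
  (trans (cong₂ _⊕_ (⊗-identityʳ g) (⊗-zeroʳ (bar f))) (⊕-identityʳ g))

⊗-embˡ : (f g p : E n) → (f ⊹ g) ⊗ (p ⊹ 0ᴱ) ≡ f ⊗ p ⊹ g ⊗ p
⊗-embˡ f g p = cong (f ⊗ p ⊹_) (trans (cong (g ⊗ p ⊕_) (⊗-zeroʳ (bar f))) (⊕-identityʳ _))

⊗-embʳ : (p f g : E n) → (p ⊹ 0ᴱ) ⊗ (f ⊹ g) ≡ p ⊗ f ⊹ bar p ⊗ g
⊗-embʳ p f g = cong (p ⊗ f ⊹_) (trans (cong (_⊕ bar p ⊗ g) (⊗-zeroˡ f)) (⊕-identityˡ _))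

-- Vectors as elements of degree one

ι : Vec ℤ n → E n
ι []      = 0ᴱ
ι (c ∷ v) = ι v ⊹ c • 1ᴱ

bar-ι : (v : Vec ℤ n) → bar (ι v) ≡ ⊖ ι v
bar-ι []      = refl
bar-ι (c ∷ v) = cong₂ _⊹_ (bar-ι v)
  (cong ⊖_ (trans (bar-• c 1ᴱ) (cong (c •_) (bar-constant 1ℤ))))

-- Moving a vector past a monomial costs one sign per generator in it, and `bar` applies exactly
-- these signs, so f need not be homogeneous.
ι-⊗ : (v : Vec ℤ n) (f : E n) → ι v ⊗ f ≡ bar f ⊗ ι v
ι-⊗ [] (scalar a) = cong scalar (trans (ℤ.*-zeroˡ a) (sym (ℤ.*-zeroʳ a)))
ι-⊗ (c ∷ v) (f ⊹ g) = cong₂ _⊹_ (ι-⊗ v f) (begin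
  (c • 1ᴱ) ⊗ f ⊕ bar (ι v) ⊗ g                   ≡⟨ ⊕-comm _ _ ⟩
  bar (ι v) ⊗ g ⊕ (c • 1ᴱ) ⊗ f                   ≡⟨ cong₂ _⊕_ left right ⟩
  ⊖ bar g ⊗ ι v ⊕ bar (bar f) ⊗ (c • 1ᴱ)         ∎)
  where
  left : bar (ι v) ⊗ g ≡ ⊖ bar g ⊗ ι v
  left = begin
    bar (ι v) ⊗ g    ≡⟨ cong (_⊗ g) (bar-ι v) ⟩
    ⊖ ι v ⊗ g        ≡⟨ ⊖-⊗ (ι v) g ⟩
    ⊖ (ι v ⊗ g)      ≡⟨ cong ⊖_ (ι-⊗ v g) ⟩
    ⊖ (bar g ⊗ ι v)  ≡⟨ ⊖-⊗ (bar g) (ι v) ⟨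
    ⊖ bar g ⊗ ι v    ∎
  right : (c • 1ᴱ) ⊗ f ≡ bar (bar f) ⊗ (c • 1ᴱ)
  right = begin
    (c • 1ᴱ) ⊗ f                ≡⟨ •-⊗ c 1ᴱ f ⟩
    c • (1ᴱ ⊗ f)                ≡⟨ cong (c •_) (⊗-identityˡ f) ⟩
    c • f                       ≡⟨ cong (c •_) (⊗-identityʳ f) ⟨
    c • (f ⊗ 1ᴱ)                ≡⟨ ⊗-• c f 1ᴱ ⟨
    f ⊗ (c • 1ᴱ)                ≡⟨ cong (_⊗ (c • 1ᴱ)) (bar-involutive f) ⟨
    bar (bar f) ⊗ (c • 1ᴱ)      ∎

ι-square : (v : Vec ℤ n) → ι v ⊗ ι v ≡ 0ᴱ
ι-square [] = refl
ι-square (c ∷ v) = cong₂ _⊹_ (ι-square v) (begin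
  (c • 1ᴱ) ⊗ ι v ⊕ bar (ι v) ⊗ (c • 1ᴱ)    ≡⟨ cong₂ _⊕_ (•-⊗ c 1ᴱ (ι v)) (⊗-• c (bar (ι v)) 1ᴱ) ⟩
  c • (1ᴱ ⊗ ι v) ⊕ c • (bar (ι v) ⊗ 1ᴱ)    ≡⟨ •-⊕ c _ _ ⟨
  c • (1ᴱ ⊗ ι v ⊕ bar (ι v) ⊗ 1ᴱ)          ≡⟨ cong (c •_) (cong₂ _⊕_ (⊗-identityˡ _) (trans (⊗-identityʳ _) (bar-ι v))) ⟩
  c • (ι v ⊕ ⊖ ι v)                        ≡⟨ cong (c •_) (⊖-inverseʳ (ι v)) ⟩
  c • 0ᴱ                                   ≡⟨ •-0ᴱ c ⟩
  0ᴱ                                       ∎)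

ι-⊗-ι : (v : Vec ℤ n) (f : E n) → ι v ⊗ (f ⊗ ι v) ≡ 0ᴱ
ι-⊗-ι v f = begin
  ι v ⊗ (f ⊗ ι v)      ≡⟨ ⊗-assoc _ _ _ ⟨
  (ι v ⊗ f) ⊗ ι v      ≡⟨ cong (_⊗ ι v) (ι-⊗ v f) ⟩
  (bar f ⊗ ι v) ⊗ ι v  ≡⟨ ⊗-assoc _ _ _ ⟩
  bar f ⊗ (ι v ⊗ ι v)  ≡⟨ cong (bar f ⊗_) (ι-square v) ⟩
  bar f ⊗ 0ᴱ           ≡⟨ ⊗-zeroʳ _ ⟩
  0ᴱ                   ∎

-- Forms attached to subsets

top : ∀ t → E (t ℕ.+ n) → E n
top zero    f       = f
top (suc t) (f ⊹ g) = top t g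

top-⊕ : ∀ t (f g : E (t ℕ.+ n)) → top t (f ⊕ g) ≡ top t f ⊕ top t g
top-⊕ zero f g = refl
top-⊕ (suc t) (f ⊹ f′) (g ⊹ g′) = top-⊕ t f′ g′

top-• : ∀ t c (f : E (t ℕ.+ n)) → top t (c • f) ≡ c • top t f
top-• zero c f = refl
top-• (suc t) c (f ⊹ g) = top-• t c g

∏ : List (Vec ℤ n) → E n
∏ []       = 1ᴱ
∏ (v ∷ vs) = ι v ⊗ ∏ vs

-- Fraction-free elimination and common factors

lincomb : ℤ → ℤ → Vec ℤ n → Vec ℤ n → Vec ℤ n
lincomb c d = Vec.zipWith (λ a b → c ℤ.* a ℤ.+ d ℤ.* b)

ι-lincomb : ∀ c d (u v : Vec ℤ n) → ι (lincomb c d u v) ≡ c • ι u ⊕ d • ι v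
ι-lincomb c d [] [] = sym (cong₂ _⊕_ (•-0ᴱ c) (•-0ᴱ d))
ι-lincomb c d (a ∷ u) (b ∷ v) = cong₂ _⊹_ (ι-lincomb c d u v)
  (trans (+-• (c ℤ.* a) (d ℤ.* b) 1ᴱ) (cong₂ _⊕_ (*-• c a 1ᴱ) (*-• d b 1ᴱ)))

ι-anticomm : (u v : Vec ℤ n) → ι u ⊗ ι v ≡ ⊖ (ι v ⊗ ι u)
ι-anticomm u v = trans (ι-⊗ u (ι v)) (trans (cong (_⊗ ι u) (bar-ι v)) (⊖-⊗ (ι v) (ι u)))

-- The outcome of clearing the first coordinate. Either no vector involves the first generator, or a
-- single pivot vector does and the others are cleared against it, at the cost of the multiplier r.
data Eliminated {n} (us : List (Vec ℤ (suc n))) : Set where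
  absent : ∀ ws → length ws ≡ length us → ∏ us ≡ (∏ ws ⊹ 0ᴱ) → Eliminated us
  pivot  : ∀ ws c u r → suc (length ws) ≡ length us → c ≢ 0ℤ → r ≢ 0ℤ →
           r • ∏ us ≡ ι (c ∷ u) ⊗ (∏ ws ⊹ 0ᴱ) → Eliminated us

*-≢0 : ∀ {c d} → c ≢ 0ℤ → d ≢ 0ℤ → c ℤ.* d ≢ 0ℤ
*-≢0 {c} c≢0 d≢0 cd≡0 with ℤ.i*j≡0⇒i≡0∨j≡0 c cd≡0
... | inj₁ c≡0 = c≢0 c≡0
... | inj₂ d≡0 = d≢0 d≡0

0•1ᴱ : ∀ {c} → c ≡ 0ℤ → c • 1ᴱ {n} ≡ 0ᴱ
0•1ᴱ refl = 0• 1ᴱ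

eliminate : (us : List (Vec ℤ (suc n))) → Eliminated us
eliminate [] = absent [] refl refl
eliminate ((c ∷ u) ∷ us) with eliminate us
... | absent ws len eq with c ℤ.≟ 0ℤ
...   | yes c≡0 = absent (u ∷ ws) (cong suc len) (begin
  (ι u ⊹ c • 1ᴱ) ⊗ ∏ us       ≡⟨ cong₂ _⊗_ (cong (ι u ⊹_) (0•1ᴱ c≡0)) eq ⟩
  (ι u ⊹ 0ᴱ) ⊗ (∏ ws ⊹ 0ᴱ)    ≡⟨ ⊗-embˡ (ι u) 0ᴱ (∏ ws) ⟩
  (ι u ⊗ ∏ ws ⊹ 0ᴱ ⊗ ∏ ws)    ≡⟨ cong (ι u ⊗ ∏ ws ⊹_) (⊗-zeroˡ (∏ ws)) ⟩
  (ι u ⊗ ∏ ws ⊹ 0ᴱ)           ∎)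
...   | no c≢0 = pivot ws c u 1ℤ (cong suc len) c≢0 (λ ())
  (trans (1• _) (cong (ι (c ∷ u) ⊗_) eq))
eliminate {n} ((c′ ∷ u′) ∷ us) | pivot ws c u r len c≢0 r≢0 eq =
  pivot (w ∷ ws) c u (c ℤ.* r) (cong suc len) c≢0 (*-≢0 c≢0 r≢0) (begin
    (c ℤ.* r) • (ι v′ ⊗ ∏ us)                  ≡⟨ *-• c r _ ⟩
    c • r • (ι v′ ⊗ ∏ us)                      ≡⟨ cong (c •_) (⊗-• r (ι v′) (∏ us)) ⟨
    c • (ι v′ ⊗ r • ∏ us)                      ≡⟨ cong (λ f → c • (ι v′ ⊗ f)) eq ⟩
    c • (ι v′ ⊗ (ι v ⊗ W))                     ≡⟨ cong (c •_) (⊗-assoc (ι v′) (ι v) W) ⟨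
    c • (ι v′ ⊗ ι v ⊗ W)                       ≡⟨ •-⊗ c (ι v′ ⊗ ι v) W ⟨
    (c • (ι v′ ⊗ ι v)) ⊗ W                     ≡⟨ cong (_⊗ W) swap ⟨
    ι v ⊗ (ι w ⊹ 0ᴱ) ⊗ W                       ≡⟨ ⊗-assoc (ι v) _ W ⟩
    ι v ⊗ ((ι w ⊹ 0ᴱ) ⊗ W)                     ≡⟨ cong (ι v ⊗_) (⊗-embˡ (ι w) 0ᴱ (∏ ws)) ⟩
    ι v ⊗ (ι w ⊗ ∏ ws ⊹ 0ᴱ ⊗ ∏ ws)             ≡⟨ cong (λ f → ι v ⊗ (ι w ⊗ ∏ ws ⊹ f)) (⊗-zeroˡ (∏ ws)) ⟩
    ι v ⊗ (ι w ⊗ ∏ ws ⊹ 0ᴱ)                    ∎)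
  where
  v = c ∷ u
  v′ = c′ ∷ u′
  -- Cross-multiplication: the first coordinate of c′ v - c v′ is c′ c - c c′ = 0. The signs are
  -- such that v ∧ (c′ v - c v′) = c (v′ ∧ v).
  w = lincomb c′ (ℤ.- c) u u′
  W = ∏ ws ⊹ 0ᴱ
  w≡ : (ι w ⊹ 0ᴱ) ≡ c′ • ι v ⊕ (ℤ.- c) • ι v′
  w≡ = trans (cong (ι w ⊹_) (sym (0•1ᴱ
      (trans (cong₂ ℤ._+_ (ℤ.*-comm c′ c) (sym (ℤ.neg-distribˡ-* c c′))) (ℤ.+-inverseʳ (c ℤ.* c′))))))
    (ι-lincomb c′ (ℤ.- c) v v′)
  swap : ι v ⊗ (ι w ⊹ 0ᴱ) ≡ c • (ι v′ ⊗ ι v)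
  swap = begin
    ι v ⊗ (ι w ⊹ 0ᴱ)                                  ≡⟨ cong (ι v ⊗_) w≡ ⟩
    ι v ⊗ (c′ • ι v ⊕ (ℤ.- c) • ι v′)                 ≡⟨ ⊗-distribˡ (ι v) _ _ ⟩
    ι v ⊗ (c′ • ι v) ⊕ ι v ⊗ ((ℤ.- c) • ι v′)         ≡⟨ cong₂ _⊕_ (⊗-• c′ _ _) (⊗-• (ℤ.- c) _ _) ⟩
    c′ • (ι v ⊗ ι v) ⊕ (ℤ.- c) • (ι v ⊗ ι v′)         ≡⟨ cong₂ (λ f g → c′ • f ⊕ (ℤ.- c) • g) (ι-square v) (ι-anticomm v v′) ⟩
    c′ • 0ᴱ ⊕ (ℤ.- c) • ⊖ (ι v′ ⊗ ι v)                ≡⟨ cong₂ _⊕_ (•-0ᴱ c′) (cong ((ℤ.- c) •_) (sym (-1• _))) ⟩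
    0ᴱ ⊕ (ℤ.- c) • ℤ.-1ℤ • (ι v′ ⊗ ι v)               ≡⟨ ⊕-identityˡ _ ⟩
    (ℤ.- c) • ℤ.-1ℤ • (ι v′ ⊗ ι v)                    ≡⟨ *-• (ℤ.- c) ℤ.-1ℤ _ ⟨
    (ℤ.- c ℤ.* ℤ.-1ℤ) • (ι v′ ⊗ ι v)                  ≡⟨ cong (_• (ι v′ ⊗ ι v)) (trans (ℤ.*-comm (ℤ.- c) ℤ.-1ℤ) (trans (ℤ.-1*i≡-i (ℤ.- c)) (ℤ.neg-involutive c))) ⟩
    c • (ι v′ ⊗ ι v)                                  ∎

eliminated : (us : List (Vec ℤ (suc n))) → ∃ λ r → r ≢ 0ℤ × ∃₂ λ X ws →
  length us ≤ suc (length ws) × r • ∏ us ≡ X ⊗ (∏ ws ⊹ 0ᴱ)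
eliminated us with eliminate us
... | absent ws len eq = 1ℤ , (λ ()) , 1ᴱ , ws , ℕ.≤-trans (ℕ.≤-reflexive (sym len)) (ℕ.n≤1+n _) ,
  trans (1• _) (trans eq (sym (⊗-identityˡ _)))
... | pivot ws c u r len _ r≢0 eq = r , r≢0 , ι (c ∷ u) , ws , ℕ.≤-reflexive (sym len) , eq

-- Taking the coefficient of one generator spends at most one common vector: after elimination only
-- the pivot involves that generator, and the product of the other vectors remains a common factor
-- of both coefficients. More than t vectors thus leave one after t extractions, and its square is
-- zero.
top-common-factors : ∀ t (us : List (Vec ℤ (t ℕ.+ n))) F G → t < length us →
  top t (F ⊗ ∏ us) ⊗ top t (G ⊗ ∏ us) ≡ 0ᴱ
top-common-factors zero (u ∷ us) F G _ = begin
  (F ⊗ (ι u ⊗ P)) ⊗ (G ⊗ (ι u ⊗ P))     ≡⟨ ⊗-assoc F _ _ ⟩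
  F ⊗ ((ι u ⊗ P) ⊗ (G ⊗ (ι u ⊗ P)))     ≡⟨ cong (F ⊗_) (⊗-assoc (ι u) P _) ⟩
  F ⊗ (ι u ⊗ (P ⊗ (G ⊗ (ι u ⊗ P))))     ≡⟨ cong (λ f → F ⊗ (ι u ⊗ f)) (trans (sym (⊗-assoc P G _)) (sym (⊗-assoc (P ⊗ G) (ι u) P))) ⟩
  F ⊗ (ι u ⊗ (P ⊗ G ⊗ ι u ⊗ P))         ≡⟨ cong (F ⊗_) (⊗-assoc (ι u) _ P) ⟨
  F ⊗ (ι u ⊗ (P ⊗ G ⊗ ι u) ⊗ P)         ≡⟨ cong (λ f → F ⊗ (f ⊗ P)) (ι-⊗-ι u (P ⊗ G)) ⟩
  F ⊗ (0ᴱ ⊗ P)                          ≡⟨ cong (F ⊗_) (⊗-zeroˡ P) ⟩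
  F ⊗ 0ᴱ                                ≡⟨ ⊗-zeroʳ F ⟩
  0ᴱ                                    ∎
  where P = ∏ us
top-common-factors {n} (suc t) us F G t<len with eliminated us
... | r , r≢0 , X , ws , len , eq =
  •-torsionFree _ r≢0 (•-torsionFree _ r≢0 (begin
    r • r • (top (suc t) (F ⊗ ∏ us) ⊗ top (suc t) (G ⊗ ∏ us))      ≡⟨ cong (r •_) (⊗-• r _ _) ⟨
    r • (top (suc t) (F ⊗ ∏ us) ⊗ r • top (suc t) (G ⊗ ∏ us))      ≡⟨ •-⊗ r _ _ ⟨
    (r • top (suc t) (F ⊗ ∏ us)) ⊗ (r • top (suc t) (G ⊗ ∏ us))    ≡⟨ cong₂ _⊗_ (scaled F) (scaled G) ⟩
    top t (xpart (F ⊗ X) ⊗ ∏ ws) ⊗ top t (xpart (G ⊗ X) ⊗ ∏ ws)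
      ≡⟨ top-common-factors t ws _ _ (ℕ.s≤s⁻¹ (ℕ.≤-trans t<len len)) ⟩
    0ᴱ                                                              ∎))
  where
  xpart : E (suc k) → E k
  xpart = top 1
  top-emb : (Y : E (suc t ℕ.+ n)) (p : E (t ℕ.+ n)) → top (suc t) (Y ⊗ (p ⊹ 0ᴱ)) ≡ top t (xpart Y ⊗ p)
  top-emb (Y₀ ⊹ Y₁) p = cong (top (suc t)) (⊗-embˡ Y₀ Y₁ p)
  scaled : ∀ H → r • top (suc t) (H ⊗ ∏ us) ≡ top t (xpart (H ⊗ X) ⊗ ∏ ws)
  scaled H = begin
    r • top (suc t) (H ⊗ ∏ us)               ≡⟨ top-• (suc t) r (H ⊗ ∏ us) ⟨
    top (suc t) (r • (H ⊗ ∏ us))             ≡⟨ cong (top (suc t)) (⊗-• r H (∏ us)) ⟨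
    top (suc t) (H ⊗ r • ∏ us)               ≡⟨ cong (λ f → top (suc t) (H ⊗ f)) eq ⟩
    top (suc t) (H ⊗ (X ⊗ (∏ ws ⊹ 0ᴱ)))      ≡⟨ cong (top (suc t)) (⊗-assoc H X _) ⟨
    top (suc t) (H ⊗ X ⊗ (∏ ws ⊹ 0ᴱ))        ≡⟨ top-emb (H ⊗ X) (∏ ws) ⟩
    top t (xpart (H ⊗ X) ⊗ ∏ ws)             ∎

select : ∀ {A : Set} → Subset k → Vec A k → List A
select []          []       = []
select (true  ∷ S) (x ∷ xs) = x ∷ select S xs
select (false ∷ S) (x ∷ xs) = select S xs

length-select : ∀ {A : Set} (S : Subset k) (xs : Vec A k) → length (select S xs) ≡ ∣ S ∣
length-select []          []       = refl
length-select (true  ∷ S) (x ∷ xs) = cong suc (length-select S xs)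
length-select (false ∷ S) (x ∷ xs) = length-select S xs

-- The vectors outside S are collected on the left, and `bar` absorbs into F the signs of moving the
-- others past them.
∏-select-⊆ : {S T : Subset k} (vs : Vec (Vec ℤ n) k) → S ⊆ T →
  ∃ λ F → ∏ (select T vs) ≡ F ⊗ ∏ (select S vs)
∏-select-⊆ {S = []} {[]} [] _ = 1ᴱ , sym (⊗-identityˡ _)
∏-select-⊆ {S = s ∷ S} {t ∷ T} (v ∷ vs) S⊆T with ∏-select-⊆ vs (Sub.drop-∷-⊆ S⊆T)
∏-select-⊆ {S = true ∷ S} {true ∷ T} (v ∷ vs) S⊆T | F , eq = bar F , (begin
  ι v ⊗ ∏ (select T vs)              ≡⟨ cong (ι v ⊗_) eq ⟩
  ι v ⊗ (F ⊗ ∏ (select S vs))        ≡⟨ ⊗-assoc _ _ _ ⟨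
  ι v ⊗ F ⊗ ∏ (select S vs)          ≡⟨ cong (_⊗ ∏ (select S vs)) (ι-⊗ v F) ⟩
  bar F ⊗ ι v ⊗ ∏ (select S vs)      ≡⟨ ⊗-assoc _ _ _ ⟩
  bar F ⊗ (ι v ⊗ ∏ (select S vs))    ∎)
∏-select-⊆ {S = true ∷ S} {false ∷ T} (v ∷ vs) S⊆T | F , eq with S⊆T here
... | ()
∏-select-⊆ {S = false ∷ S} {true ∷ T} (v ∷ vs) S⊆T | F , eq =
  ι v ⊗ F , trans (cong (ι v ⊗_) eq) (sym (⊗-assoc _ _ _))
∏-select-⊆ {S = false ∷ S} {false ∷ T} (v ∷ vs) S⊆T | F , eq = F , eq

-- The element called ω_S in the overview.
form : ∀ t → Vec (Vec ℤ (t ℕ.+ n)) k → Subset k → E n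
form t vs S = top t (∏ (select S vs))

form-vanishing : ∀ t (vs : Vec (Vec ℤ (t ℕ.+ n)) k) (S T : Subset k) →
  ∣ S ∩ T ∣ > t → form t vs S ⊗ form t vs T ≡ 0ᴱ
form-vanishing t vs S T t<
  with F , eqF ← ∏-select-⊆ vs (Sub.p∩q⊆p S T)
  with G , eqG ← ∏-select-⊆ vs (Sub.p∩q⊆q S T)
  rewrite eqF | eqG
  = top-common-factors t (select (S ∩ T) vs) F G
      (subst (t <_) (sym (length-select (S ∩ T) vs)) t<)

-- Commutation up to sign

bar^ : ℕ → E n → E n
bar^ zero    f = f
bar^ (suc d) f = bar (bar^ d f)

bar^-emb : ∀ d (f : E n) → bar^ d (f ⊹ 0ᴱ) ≡ (bar^ d f ⊹ 0ᴱ)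
bar^-emb zero    f = refl
bar^-emb (suc d) f rewrite bar^-emb d f =
  cong (bar (bar^ d f) ⊹_) (trans (cong ⊖_ (bar-constant 0ℤ)) ⊖-0ᴱ)

-- What homogeneity gives for commutation. Only the parity of d matters, as `bar` is an involution.
GradedCentral : E n → Set
GradedCentral f = ∃ λ d → ∀ h → f ⊗ h ≡ bar^ d h ⊗ f

∏-gradedCentral : (vs : List (Vec ℤ n)) → GradedCentral (∏ vs)
∏-gradedCentral [] = 0 , λ h → trans (⊗-identityˡ h) (sym (⊗-identityʳ h))
∏-gradedCentral (v ∷ vs) with ∏-gradedCentral vs
... | d , comm = suc d , λ h → begin
  ι v ⊗ ∏ vs ⊗ h                 ≡⟨ ⊗-assoc _ _ _ ⟩
  ι v ⊗ (∏ vs ⊗ h)               ≡⟨ cong (ι v ⊗_) (comm h) ⟩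
  ι v ⊗ (bar^ d h ⊗ ∏ vs)        ≡⟨ ⊗-assoc _ _ _ ⟨
  ι v ⊗ bar^ d h ⊗ ∏ vs          ≡⟨ cong (_⊗ ∏ vs) (ι-⊗ v _) ⟩
  bar^ (suc d) h ⊗ ι v ⊗ ∏ vs    ≡⟨ ⊗-assoc _ _ _ ⟩
  bar^ (suc d) h ⊗ (ι v ⊗ ∏ vs)  ∎

-- Testing against elements free of the first generator and comparing its coefficients adds one
-- `bar`. The degree drops while the exponent grows, but the parities agree.
top-gradedCentral : ∀ t (f : E (t ℕ.+ n)) → GradedCentral f → GradedCentral (top t f)
top-gradedCentral zero f central = central
top-gradedCentral (suc t) (f ⊹ g) (d , comm) = top-gradedCentral t g (suc d , λ h → ⊹-injectiveʳ (begin
  (f ⊗ h ⊹ g ⊗ h)                           ≡⟨ ⊗-embˡ f g h ⟨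
  (f ⊹ g) ⊗ (h ⊹ 0ᴱ)                        ≡⟨ comm (h ⊹ 0ᴱ) ⟩
  bar^ d (h ⊹ 0ᴱ) ⊗ (f ⊹ g)                 ≡⟨ cong (_⊗ (f ⊹ g)) (bar^-emb d h) ⟩
  (bar^ d h ⊹ 0ᴱ) ⊗ (f ⊹ g)                 ≡⟨ ⊗-embʳ (bar^ d h) f g ⟩
  (bar^ d h ⊗ f ⊹ bar (bar^ d h) ⊗ g)       ∎))

form-gradedCentral : ∀ t (vs : Vec (Vec ℤ (t ℕ.+ n)) k) S → GradedCentral (form t vs S)
form-gradedCentral t vs S = top-gradedCentral t _ (∏-gradedCentral (select S vs))

-- Leading monomials

-- In lexicographic order, f has leading monomial S and its coefficient satisfies U.
Lead : (ℤ → Set) → E n → Subset n → Set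
Lead U (scalar a) []          = U a
Lead U (f ⊹ g)    (true  ∷ S) = Lead U g S
Lead U (f ⊹ g)    (false ∷ S) = g ≡ 0ᴱ × Lead U f S

module _ {U : ℤ → Set} (U-neg : ∀ {a} → U a → U (ℤ.- a)) where

  lead-⊖ : (f : E n) (S : Subset n) → Lead U f S → Lead U (⊖ f) S
  lead-⊖ (scalar a) []          p         = U-neg p
  lead-⊖ (f ⊹ g)    (true  ∷ S) p         = lead-⊖ g S p
  lead-⊖ (f ⊹ g)    (false ∷ S) (eq , p) = trans (cong ⊖_ eq) ⊖-0ᴱ , lead-⊖ f S p

  lead-bar : (f : E n) (S : Subset n) → Lead U f S → Lead U (bar f) S
  lead-bar (scalar a) []          p         = p
  lead-bar (f ⊹ g)    (true  ∷ S) p         = lead-⊖ (bar g) S (lead-bar g S p)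
  lead-bar (f ⊹ g)    (false ∷ S) (eq , p) =
    trans (cong ⊖_ (trans (cong bar eq) (bar-constant 0ℤ))) ⊖-0ᴱ , lead-bar f S p

  module _ (U-* : ∀ {a b} → U a → U b → U (a ℤ.* b)) where

    -- The order respects multiplication by disjoint monomials, so the leading terms multiply
    -- without cancellation. The new coefficient is the product of the old ones up to sign, hence
    -- the two closure conditions on U.
    lead-⊗ : (f g : E n) (S T : Subset n) → ∣ S ∩ T ∣ ≡ 0 →
             Lead U f S → Lead U g T → Lead U (f ⊗ g) (S ∪ T)
    lead-⊗ (scalar a) (scalar b) [] [] _ p q = U-* p q
    lead-⊗ (f ⊹ f′) (g ⊹ .0ᴱ) (true ∷ S) (false ∷ T) dis p (refl , q) =
      subst (λ h → Lead U h (S ∪ T)) (sym (⊹-injectiveʳ (⊗-embˡ f f′ g))) (lead-⊗ f′ g S T dis p q)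
    lead-⊗ (f ⊹ .0ᴱ) (g ⊹ g′) (false ∷ S) (true ∷ T) dis (refl , p) q =
      subst (λ h → Lead U h (S ∪ T)) (sym (⊹-injectiveʳ (⊗-embʳ f g g′)))
        (lead-⊗ (bar f) g′ S T dis (lead-bar f S p) q)
    lead-⊗ (f ⊹ .0ᴱ) (g ⊹ .0ᴱ) (false ∷ S) (false ∷ T) dis (refl , p) (refl , q) =
      trans (⊹-injectiveʳ (⊗-embˡ f 0ᴱ g)) (⊗-zeroˡ g) , lead-⊗ f g S T dis p q

lead-top : ∀ {U : ℤ → Set} t (f : E (t ℕ.+ n)) (S : Subset n) →
           Lead U f (Vec.replicate t true Vec.++ S) → Lead U (top t f) S
lead-top zero    f       S p = p
lead-top (suc t) (f ⊹ g) S p = lead-top t g S p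

monomial : Subset n → E n
monomial []          = scalar 1ℤ
monomial (true  ∷ S) = 0ᴱ ⊹ monomial S
monomial (false ∷ S) = monomial S ⊹ 0ᴱ

lead-monomial : ∀ {U : ℤ → Set} → U 1ℤ → (S : Subset n) → Lead U (monomial S) S
lead-monomial u []          = u
lead-monomial u (true  ∷ S) = lead-monomial u S
lead-monomial u (false ∷ S) = refl , lead-monomial u S

NonZeroᶻ : ℤ → Set
NonZeroᶻ a = a ≢ 0ℤ

neg-≢0 : ∀ {a} → a ≢ 0ℤ → ℤ.- a ≢ 0ℤ
neg-≢0 {a} a≢0 -a≡0 = a≢0 (trans (sym (ℤ.neg-involutive a)) (cong ℤ.-_ -a≡0))

lead⇒≢0 : (f : E n) (S : Subset n) → Lead NonZeroᶻ f S → f ≢ 0ᴱ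
lead⇒≢0 (scalar a) []          p       refl = p refl
lead⇒≢0 (f ⊹ g)    (true  ∷ S) p       eq   = lead⇒≢0 g S p (⊹-injectiveʳ eq)
lead⇒≢0 (f ⊹ g)    (false ∷ S) (_ , p) eq   = lead⇒≢0 f S p (⊹-injectiveˡ eq)

-- Every monomial S occurring in f has c + ∣ S ∣ = d.
Hom : ℕ → ℕ → E n → Set
Hom c d (scalar a) = c ≢ d → a ≡ 0ℤ
Hom c d (f ⊹ g)    = Hom c d f × Hom (suc c) d g

hom-0ᴱ : ∀ c d → Hom c d (0ᴱ {n})
hom-0ᴱ {zero}  c d _ = refl
hom-0ᴱ {suc n} c d   = hom-0ᴱ c d , hom-0ᴱ (suc c) d

hom-⊕ : ∀ c d (f g : E n) → Hom c d f → Hom c d g → Hom c d (f ⊕ g)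
hom-⊕ c d (scalar a) (scalar b) p q c≢d = cong₂ ℤ._+_ (p c≢d) (q c≢d)
hom-⊕ c d (f ⊹ f′) (g ⊹ g′) (p , p′) (q , q′) = hom-⊕ c d f g p q , hom-⊕ (suc c) d f′ g′ p′ q′

hom-• : ∀ c d a (f : E n) → Hom c d f → Hom c d (a • f)
hom-• c d a (scalar b) p c≢d = trans (cong (a ℤ.*_) (p c≢d)) (ℤ.*-zeroʳ a)
hom-• c d a (f ⊹ g) (p , q) = hom-• c d a f p , hom-• (suc c) d a g q

hom-⊖ : ∀ c d (f : E n) → Hom c d f → Hom c d (⊖ f)
hom-⊖ c d f p = subst (Hom c d) (-1• f) (hom-• c d ℤ.-1ℤ f p)

hom-bar : ∀ c d (f : E n) → Hom c d f → Hom c d (bar f)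
hom-bar c d (scalar a) p = p
hom-bar c d (f ⊹ g) (p , q) = hom-bar c d f p , hom-⊖ (suc c) d (bar g) (hom-bar (suc c) d g q)

hom-⊗ : ∀ c d c′ d′ (f g : E n) → Hom c d f → Hom c′ d′ g → Hom (c ℕ.+ c′) (d ℕ.+ d′) (f ⊗ g)
hom-⊗ c d c′ d′ (scalar a) (scalar b) p q ≢ with c ℕ.≟ d | c′ ℕ.≟ d′
... | no c≢d   | _          = trans (cong (ℤ._* b) (p c≢d)) (ℤ.*-zeroˡ b)
... | yes _    | no c′≢d′   = trans (cong (a ℤ.*_) (q c′≢d′)) (ℤ.*-zeroʳ a)
... | yes c≡d  | yes c′≡d′  = contradiction (cong₂ ℕ._+_ c≡d c′≡d′) ≢
hom-⊗ c d c′ d′ (f ⊹ f′) (g ⊹ g′) (p , p′) (q , q′) =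
  hom-⊗ c d c′ d′ f g p q ,
  hom-⊕ _ _ (f′ ⊗ g) (bar f ⊗ g′)
    (hom-⊗ (suc c) d c′ d′ f′ g p′ q)
    (subst (λ e → Hom e (d ℕ.+ d′) (bar f ⊗ g′)) (ℕ.+-suc c c′)
      (hom-⊗ c d (suc c′) d′ (bar f) g′ (hom-bar c d f p) q′))

hom-pred : ∀ c d (f : E n) → Hom (suc c) (suc d) f → Hom c d f
hom-pred c d (scalar a) p c≢d = p (λ eq → c≢d (ℕ.suc-injective eq))
hom-pred c d (f ⊹ g) (p , q) = hom-pred c d f p , hom-pred (suc c) d g q

hom-top : ∀ t d (f : E (t ℕ.+ n)) → Hom 0 (t ℕ.+ d) f → Hom 0 d (top t f)
hom-top zero    d f       p       = p
hom-top (suc t) d (f ⊹ g) (_ , p) = hom-top t d g (hom-pred 0 (t ℕ.+ d) g p)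

hom-constant : ∀ c a → Hom c c (constant {n} a)
hom-constant {zero}  c a c≢c = contradiction refl c≢c
hom-constant {suc n} c a     = hom-constant c a , hom-0ᴱ (suc c) c

hom-ι : ∀ c (v : Vec ℤ n) → Hom c (suc c) (ι v)
hom-ι c []      _ = refl
hom-ι c (a ∷ v)   = hom-ι c v , hom-• (suc c) (suc c) a 1ᴱ (hom-constant (suc c) 1ℤ)

hom-∏ : (vs : List (Vec ℤ n)) → Hom 0 (length vs) (∏ vs)
hom-∏ []       = hom-constant 0 1ℤ
hom-∏ (v ∷ vs) = hom-⊗ 0 1 0 (length vs) (ι v) (∏ vs) (hom-ι 0 v) (hom-∏ vs)

hom-form : ∀ t d (vs : Vec (Vec ℤ (t ℕ.+ n)) k) (S : Subset k) →
           ∣ S ∣ ≡ t ℕ.+ d → Hom 0 d (form t vs S)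
hom-form t d vs S ∣S∣≡ = hom-top t d (∏ (select S vs))
  (subst (λ l → Hom 0 l (∏ (select S vs))) (trans (length-select S vs) ∣S∣≡) (hom-∏ (select S vs)))

hom-monomial : ∀ c (S : Subset n) → Hom c (c ℕ.+ ∣ S ∣) (monomial S)
hom-monomial c []          c≢ = contradiction (sym (ℕ.+-identityʳ c)) c≢
hom-monomial c (true  ∷ S) =
  hom-0ᴱ c _ , subst (λ d → Hom (suc c) d (monomial S)) (sym (ℕ.+-suc c ∣ S ∣)) (hom-monomial (suc c) S)
hom-monomial c (false ∷ S) = hom-monomial c S , hom-0ᴱ (suc c) _

lead-hom : ∀ c d (f : E n) (S : Subset n) → Lead NonZeroᶻ f S → Hom c d f → c ℕ.+ ∣ S ∣ ≡ d
lead-hom c d (scalar a) [] a≢0 p =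
  trans (ℕ.+-identityʳ c) (decidable-stable (c ℕ.≟ d) (λ c≢d → a≢0 (p c≢d)))
lead-hom c d (f ⊹ g) (true ∷ S) l (_ , q) = trans (ℕ.+-suc c ∣ S ∣) (lead-hom (suc c) d g S l q)
lead-hom c d (f ⊹ g) (false ∷ S) (_ , l) (p , _) = lead-hom c d f S l p

-- ω modulo the submodule J can be reduced to an element whose leading monomial
-- is not one of J; the ring has no division, whence the multiplier c.
new-leading-monomial : (J : E n → Set) (ω : E n) → J 0ᴱ →
  (∀ {f g} → J f → J g → J (f ⊕ g)) → (∀ c {f} → J f → J (c • f)) →
  (∀ c → c ≢ 0ℤ → ¬ J (c • ω)) →
  ¬ ¬ (∃ λ S → ∃₂ λ c j → J j × Lead NonZeroᶻ (c • ω ⊕ j) S × (∀ g → J g → ¬ Lead NonZeroᶻ g S))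
new-leading-monomial J (scalar a) J-0 J-⊕ J-• ω∉J ¬goal = ¬goal
  ([] , 1ℤ , 0ᴱ , J-0
  , (λ eq → ω∉J 1ℤ (λ ()) (subst J (cong scalar (trans (sym eq) (ℤ.+-identityʳ _))) J-0))
  -- A scalar b ≠ 0 in J would put its multiple a b into J, which is also the multiple b • ω.
  , λ { (scalar b) Jb b≢0 → ω∉J b b≢0 (subst J (cong scalar (ℤ.*-comm a b)) (J-• a Jb)) })
new-leading-monomial J (ω₀ ⊹ ω₁) J-0 J-⊕ J-• ω∉J ¬goal =
  -- The case distinction is whether J can cancel the part of some multiple of ω containing the
  -- first generator. If so, that part is removed and the reduction continues among elements free of
  -- the generator. If not, the generator belongs to the new leading monomial, and only the
  -- coefficients of the generator matter.
  ¬¬-excluded-middle {A = ∃ λ c → c ≢ 0ℤ × ∃ λ g₀ → J (g₀ ⊹ c • ω₁)} λ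
  { (yes (c , c≢0 , g₀ , Jg)) →
      new-leading-monomial (λ h → J (h ⊹ 0ᴱ)) (c • ω₀ ⊕ ⊖ g₀) J-0
        (λ {f} {g} p q → subst J (cong (f ⊕ g ⊹_) (⊕-identityˡ 0ᴱ)) (J-⊕ p q))
        (λ a {f} p → subst J (cong (a • f ⊹_) (•-0ᴱ a)) (J-• a p))
        (λ c′ c′≢0 p → ω∉J (c′ ℤ.* c) (*-≢0 c′≢0 c≢0)
          (subst J (cong₂ _⊹_ (restore c c′ g₀) (trans (⊕-identityˡ _) (sym (*-• c′ c ω₁))))
            (J-⊕ p (J-• c′ Jg))))
        λ { (S , c′ , j , Jj , lead , new) → ¬goal
          ( false ∷ S , c′ ℤ.* c , (j ⊹ 0ᴱ) ⊕ (ℤ.- c′) • (g₀ ⊹ c • ω₁) , J-⊕ Jj (J-• (ℤ.- c′) Jg)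
          , (cancel c c′ , subst (λ f → Lead NonZeroᶻ f S) (reduced c c′ g₀ j) lead)
          , λ { (h ⊹ .0ᴱ) Jh (refl , l) → new h Jh l } ) }
  ; (no none) →
      new-leading-monomial (λ h → ∃ λ g₀ → J (g₀ ⊹ h)) ω₁ (0ᴱ , J-0)
        (λ (g₀ , p) (h₀ , q) → g₀ ⊕ h₀ , J-⊕ p q)
        (λ a (g₀ , p) → a • g₀ , J-• a p)
        (λ c c≢0 (g₀ , p) → none (c , c≢0 , g₀ , p))
        λ { (S , c , j , (j₀ , Jj) , lead , new) → ¬goal
          (true ∷ S , c , (j₀ ⊹ j) , Jj , lead , λ { (g₀ ⊹ g) Jg l → new g (g₀ , Jg) l }) } }
  where
  restore : ∀ c c′ g₀ → c′ • (c • ω₀ ⊕ ⊖ g₀) ⊕ c′ • g₀ ≡ (c′ ℤ.* c) • ω₀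
  restore c c′ g₀ = begin
    c′ • (c • ω₀ ⊕ ⊖ g₀) ⊕ c′ • g₀    ≡⟨ •-⊕ c′ _ g₀ ⟨
    c′ • (c • ω₀ ⊕ ⊖ g₀ ⊕ g₀)         ≡⟨ cong (c′ •_) (⊕-assoc _ _ _) ⟩
    c′ • (c • ω₀ ⊕ (⊖ g₀ ⊕ g₀))       ≡⟨ cong (λ f → c′ • (c • ω₀ ⊕ f)) (⊖-inverseˡ g₀) ⟩
    c′ • (c • ω₀ ⊕ 0ᴱ)                ≡⟨ cong (c′ •_) (⊕-identityʳ _) ⟩
    c′ • c • ω₀                       ≡⟨ *-• c′ c ω₀ ⟨
    (c′ ℤ.* c) • ω₀                   ∎
  cancel : ∀ c c′ → (c′ ℤ.* c) • ω₁ ⊕ (0ᴱ ⊕ (ℤ.- c′) • c • ω₁) ≡ 0ᴱ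
  cancel c c′ = begin
    (c′ ℤ.* c) • ω₁ ⊕ (0ᴱ ⊕ (ℤ.- c′) • c • ω₁)   ≡⟨ cong₂ _⊕_ (*-• c′ c ω₁) (⊕-identityˡ _) ⟩
    c′ • c • ω₁ ⊕ (ℤ.- c′) • c • ω₁              ≡⟨ +-• c′ (ℤ.- c′) _ ⟨
    (c′ ℤ.+ ℤ.- c′) • c • ω₁                     ≡⟨ cong (_• (c • ω₁)) (ℤ.+-inverseʳ c′) ⟩
    0ℤ • c • ω₁                                  ≡⟨ 0• _ ⟩
    0ᴱ                                           ∎
  •-⊖ : ∀ c f → c • ⊖ f ≡ (ℤ.- c) • f
  •-⊖ c f = begin
    c • ⊖ f               ≡⟨ cong (c •_) (-1• f) ⟨
    c • ℤ.-1ℤ • f         ≡⟨ •-comm c ℤ.-1ℤ f ⟩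
    ℤ.-1ℤ • c • f         ≡⟨ *-• ℤ.-1ℤ c f ⟨
    (ℤ.-1ℤ ℤ.* c) • f     ≡⟨ cong (_• f) (ℤ.-1*i≡-i c) ⟩
    (ℤ.- c) • f           ∎
  reduced : ∀ c c′ g₀ j → c′ • (c • ω₀ ⊕ ⊖ g₀) ⊕ j ≡ (c′ ℤ.* c) • ω₀ ⊕ (j ⊕ (ℤ.- c′) • g₀)
  reduced c c′ g₀ j = begin
    c′ • (c • ω₀ ⊕ ⊖ g₀) ⊕ j                      ≡⟨ cong (_⊕ j) (•-⊕ c′ _ _) ⟩
    c′ • c • ω₀ ⊕ c′ • ⊖ g₀ ⊕ j                   ≡⟨ ⊕-assoc _ _ _ ⟩
    c′ • c • ω₀ ⊕ (c′ • ⊖ g₀ ⊕ j)                 ≡⟨ cong₂ _⊕_ (sym (*-• c′ c ω₀)) (⊕-comm _ j) ⟩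
    (c′ ℤ.* c) • ω₀ ⊕ (j ⊕ c′ • ⊖ g₀)             ≡⟨ cong (λ f → (c′ ℤ.* c) • ω₀ ⊕ (j ⊕ f)) (•-⊖ c′ g₀) ⟩
    (c′ ℤ.* c) • ω₀ ⊕ (j ⊕ (ℤ.- c′) • g₀)         ∎

-- Left ideals and the antichain of leading monomials

data Ideal {n m} (ω : Fin m → E n) (P : Fin m → Set) : E n → Set where
  gen  : ∀ {i} → P i → Ideal ω P (ω i)
  zero : Ideal ω P 0ᴱ
  add  : ∀ {f g} → Ideal ω P f → Ideal ω P g → Ideal ω P (f ⊕ g)
  mul  : ∀ h {f} → Ideal ω P f → Ideal ω P (h ⊗ f)

module _ {ω : Fin m → E n} where

  ideal-mono : ∀ {P Q : Fin m → Set} {f} → (∀ {i} → P i → Q i) → Ideal ω P f → Ideal ω Q f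
  ideal-mono P⇒Q (gen p)   = gen (P⇒Q p)
  ideal-mono P⇒Q zero      = zero
  ideal-mono P⇒Q (add p q) = add (ideal-mono P⇒Q p) (ideal-mono P⇒Q q)
  ideal-mono P⇒Q (mul h p) = mul h (ideal-mono P⇒Q p)

  ideal-• : ∀ {P f} c → Ideal ω P f → Ideal ω P (c • f)
  ideal-• {f = f} c p = subst (Ideal ω _) (trans (•-⊗ c 1ᴱ f) (cong (c •_) (⊗-identityˡ f))) (mul (c • 1ᴱ) p)

  ideal-annihilates : ∀ {P f} η → (∀ {i} → P i → ω i ⊗ η ≡ 0ᴱ) → Ideal ω P f → f ⊗ η ≡ 0ᴱ
  ideal-annihilates η ann (gen p) = ann p
  ideal-annihilates η ann zero    = ⊗-zeroˡ η
  ideal-annihilates η ann (add {f} {g} p q) = trans (⊗-distribʳ η f g)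
    (trans (cong₂ _⊕_ (ideal-annihilates η ann p) (ideal-annihilates η ann q)) (⊕-identityˡ 0ᴱ))
  ideal-annihilates η ann (mul h {f} p) =
    trans (⊗-assoc h f η) (trans (cong (h ⊗_) (ideal-annihilates η ann p)) (⊗-zeroʳ h))

  -- Here ψ stands on the side on which the ideal is multiplied, so it has to pass the multiplier h
  -- before it meets a generator; graded centrality permits this.
  gradedCentral-annihilates : ∀ {P f ψ} → GradedCentral ψ → (∀ {i} → P i → ψ ⊗ ω i ≡ 0ᴱ) →
                              Ideal ω P f → ψ ⊗ f ≡ 0ᴱ
  gradedCentral-annihilates c ann (gen p) = ann p
  gradedCentral-annihilates {ψ = ψ} c ann zero = ⊗-zeroʳ ψ
  gradedCentral-annihilates {ψ = ψ} c ann (add {f} {g} p q) = trans (⊗-distribˡ ψ f g)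
    (trans (cong₂ _⊕_ (gradedCentral-annihilates c ann p) (gradedCentral-annihilates c ann q)) (⊕-identityˡ 0ᴱ))
  gradedCentral-annihilates {ψ = ψ} c@(d , comm) ann (mul h {f} p) = begin
    ψ ⊗ (h ⊗ f)           ≡⟨ ⊗-assoc ψ h f ⟨
    ψ ⊗ h ⊗ f             ≡⟨ cong (_⊗ f) (comm h) ⟩
    bar^ d h ⊗ ψ ⊗ f      ≡⟨ ⊗-assoc (bar^ d h) ψ f ⟩
    bar^ d h ⊗ (ψ ⊗ f)    ≡⟨ cong (bar^ d h ⊗_) (gradedCentral-annihilates c ann p) ⟩
    bar^ d h ⊗ 0ᴱ         ≡⟨ ⊗-zeroʳ (bar^ d h) ⟩
    0ᴱ                    ∎

complement-in : (S T : Subset n) → ∣ S ∩ T ∣ ≡ ∣ S ∣ →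
  ∃ λ R → ∣ R ∩ S ∣ ≡ 0 × R ∪ S ≡ T × ∣ R ∣ ℕ.+ ∣ S ∣ ≡ ∣ T ∣
complement-in [] [] _ = [] , refl , refl , refl
complement-in (true ∷ S) (true ∷ T) eq with complement-in S T (ℕ.suc-injective eq)
... | R , p , q , r = false ∷ R , p , cong (true ∷_) q , trans (ℕ.+-suc ∣ R ∣ ∣ S ∣) (cong suc r)
complement-in (true ∷ S) (false ∷ T) eq =
  contradiction (subst (_≤ ∣ S ∣) eq (Sub.∣p∩q∣≤∣p∣ S T)) (ℕ.<-irrefl refl)
complement-in (false ∷ S) (true ∷ T) eq with complement-in S T eq
... | R , p , q , r = true ∷ R , p , cong (true ∷_) q , cong suc r
complement-in (false ∷ S) (false ∷ T) eq with complement-in S T eq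
... | R , p , q , r = false ∷ R , p , cong (false ∷_) q , r

-- Finitely many double negations can be opened one after another; this yields all m reductions at
-- once.
¬¬-∀ : {P : Fin m → Set} → (∀ i → ¬ ¬ P i) → ¬ ¬ (∀ i → P i)
¬¬-∀ {zero}  f k = k (λ ())
¬¬-∀ {suc m} f k = f Fin.zero λ p → ¬¬-∀ (λ i → f (Fin.suc i)) λ ps →
  k λ { Fin.zero → p ; (Fin.suc i) → ps i }

∣∩∣-maximal : (S T : Subset n) → ∣ S ∩ T ∣ ≡ ∣ S ∣ → ∣ T ∣ ≤ ∣ S ∣ → ∣ T ∩ S ∣ ≡ ∣ T ∣
∣∩∣-maximal S T eq le = ℕ.≤-antisym (Sub.∣p∩q∣≤∣p∣ T S)
  (ℕ.≤-trans le (ℕ.≤-reflexive (trans (sym eq) (cong ∣_∣ (Sub.∩-comm S T)))))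

intersecting-antichain : (ω η : Fin m → E n) (d : Fin m → ℕ) →
  (∀ i → Hom 0 (d i) (ω i)) → (∀ i → GradedCentral (ω i)) →
  (∀ i j → ω i ⊗ ω j ≡ 0ᴱ) →
  (∀ i j → i Fin.< j → ω i ⊗ η j ≡ 0ᴱ) → (∀ i → ω i ⊗ η i ≢ 0ᴱ) →
  (∀ i j → i Fin.≤ j → d i ≤ d j) →
  ¬ ¬ (∃ λ (S : Fin m → Subset n) → (∀ i → ∣ S i ∣ ≡ d i) ×
       (∀ i j → ∣ S i ∩ S j ∣ ≢ 0) × (∀ i j → i ≢ j → ∣ S i ∩ S j ∣ ≢ ∣ S i ∣))
intersecting-antichain {m} {n} ω η d hom central ωω≡0 ωη≡0 ωη≢0 mono ¬goal =
  ¬¬-∀ reduce λ red → ¬goal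
    ( (λ i → proj₁ (red i))
    , size red
    , meets red
    , λ i j i≢j → antichain red i j i≢j )
  where
  -- Keeping only degree `d k` makes the reduced element homogeneous, so its leading monomial has
  -- exactly `d k` elements.
  J : Fin m → E n → Set
  J k f = Ideal ω (λ i → i Fin.< k) f × Hom 0 (d k) f

  Reduced : Fin m → Set
  Reduced k = ∃ λ S → ∃₂ λ c j → J k j × Lead NonZeroᶻ (c • ω k ⊕ j) S ×
              (∀ g → J k g → ¬ Lead NonZeroᶻ g S)

  reduce : ∀ k → ¬ ¬ Reduced k
  reduce k = new-leading-monomial (J k) (ω k) (zero , hom-0ᴱ 0 (d k))
    (λ {f} {g} (p , p′) (q , q′) → add p q , hom-⊕ 0 (d k) f g p′ q′)
    (λ c {f} (p , p′) → ideal-• c p , hom-• 0 (d k) c f p′)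
    -- η k annihilates the ideal of the predecessors but no nonzero multiple of ω k; this is where
    -- the condition on i < j enters.
    (λ c c≢0 (p , _) → ωη≢0 k (•-torsionFree _ c≢0
      (trans (sym (•-⊗ c (ω k) (η k))) (ideal-annihilates (η k) (λ i<k → ωη≡0 _ k i<k) p))))

  module _ (red : ∀ k → Reduced k) where
    S : Fin m → Subset n
    S k = proj₁ (red k)

    f : Fin m → E n
    f k with red k
    ... | _ , c , j , _ = c • ω k ⊕ j

    f-lead : ∀ k → Lead NonZeroᶻ (f k) (S k)
    f-lead k with red k
    ... | _ , _ , _ , _ , l , _ = l

    f-hom : ∀ k → Hom 0 (d k) (f k)
    f-hom k with red k
    ... | _ , c , j , (_ , h) , _ = hom-⊕ 0 (d k) _ j (hom-• 0 (d k) c (ω k) (hom k)) h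

    f-ideal : ∀ {P : Fin m → Set} k → P k → (∀ {i} → i Fin.< k → P i) → Ideal ω P (f k)
    f-ideal k Pk P< with red k
    ... | _ , c , j , (p , _) , _ = add (ideal-• c (gen Pk)) (ideal-mono P< p)

    S-new : ∀ k g → J k g → ¬ Lead NonZeroᶻ g (S k)
    S-new k with red k
    ... | _ , _ , _ , _ , _ , new = new

    size : ∀ k → ∣ S k ∣ ≡ d k
    size k = lead-hom 0 (d k) (f k) (S k) (f-lead k) (f-hom k)

    meets : ∀ i j → ∣ S i ∩ S j ∣ ≢ 0
    meets i j ∣∩∣≡0 = lead⇒≢0 (f i ⊗ f j) (S i ∪ S j)
      (lead-⊗ neg-≢0 *-≢0 (f i) (f j) (S i) (S j) ∣∩∣≡0 (f-lead i) (f-lead j))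
      -- Both factors lie in the ideal of all ω. Each ω i annihilates `f j` from the left, and
      -- therefore so does everything in that ideal, including `f i`.
      (ideal-annihilates (f j)
        (λ {i} _ → gradedCentral-annihilates (central i) (λ {j} _ → ωω≡0 i j) (f-ideal {λ _ → ⊤} j tt _))
        (f-ideal {λ _ → ⊤} i tt _))

    -- If S i were contained in S j, multiplying `f i` by the monomial of the difference would give
    -- an element of `J j` with leading monomial S j, which the reduction at j excludes.
    not-above : ∀ i j → i Fin.< j → ∣ S i ∩ S j ∣ ≢ ∣ S i ∣
    not-above i j i<j eq with complement-in (S i) (S j) eq
    ... | R , dis , R∪S≡ , ∣R∣+∣S∣≡ = S-new j (monomial R ⊗ f i)
      ( mul (monomial R) (f-ideal i i<j (λ k<i → ℕ.<-trans k<i i<j))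
      , subst (λ e → Hom 0 e (monomial R ⊗ f i))
          (trans (cong (∣ R ∣ ℕ.+_) (sym (size i))) (trans ∣R∣+∣S∣≡ (size j)))
          (hom-⊗ 0 ∣ R ∣ 0 (d i) (monomial R) (f i) (hom-monomial 0 R) (f-hom i)) )
      (subst (Lead NonZeroᶻ (monomial R ⊗ f i)) R∪S≡
        (lead-⊗ neg-≢0 *-≢0 (monomial R) (f i) R (S i) dis (lead-monomial (λ ()) R) (f-lead i)))

    antichain : ∀ i j → i ≢ j → ∣ S i ∩ S j ∣ ≢ ∣ S i ∣
    antichain i j i≢j eq with Fin.<-cmp i j
    ... | tri< i<j _ _ = not-above i j i<j eq
    ... | tri≈ _ i≡j _ = i≢j i≡j
    -- The later set is at least as large, so its containment in the earlier one is an equality and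
    -- may be read in the other direction.
    ... | tri> _ _ j<i = not-above j i j<i (∣∩∣-maximal (S i) (S j) eq
      (subst₂ _≤_ (sym (size j)) (sym (size i)) (mono j i (ℕ.<⇒≤ j<i))))

-- General position

-- The coefficient is 1 or -1. Unlike being nonzero, this survives reduction modulo every p ≥ 2.
UnitCoefficient : ℤ → Set
UnitCoefficient a = ℤ.∣ a ∣ ≡ 1

unit-neg : ∀ {a} → UnitCoefficient a → UnitCoefficient (ℤ.- a)
unit-neg {a} p = trans (ℤ.∣-i∣≡∣i∣ a) p

unit-* : ∀ {a b} → UnitCoefficient a → UnitCoefficient b → UnitCoefficient (a ℤ.* b)
unit-* {a} {b} p q = trans (ℤ.abs-* a b) (cong₂ ℕ._*_ p q)

data Remove : Fin n → Subset n → Subset n → Set where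
  here  : ∀ {S : Subset n} → Remove Fin.zero (true ∷ S) (false ∷ S)
  there : ∀ {j b} {S S′ : Subset n} → Remove j S S′ → Remove (Fin.suc j) (b ∷ S) (b ∷ S′)

remove-size : ∀ {j} {S S′ : Subset n} → Remove j S S′ → ∣ S ∣ ≡ suc ∣ S′ ∣
remove-size here = refl
remove-size (there {b = true}  r) = cong suc (remove-size r)
remove-size (there {b = false} r) = remove-size r

remove-both : (S T : Subset n) → 0 < ∣ S ∩ T ∣ → ∃ λ j → ∃₂ λ S′ T′ →
  Remove j S S′ × Remove j T T′ ×
  ∣ S ∩ T ∣ ≡ suc ∣ S′ ∩ T′ ∣ × ∣ S ∩ T ∣ ≡ suc ∣ S′ ∩ T ∣
remove-both [] [] ()
remove-both (true ∷ S) (true ∷ T) _ = Fin.zero , false ∷ S , false ∷ T , here , here , refl , refl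
remove-both (true ∷ S) (false ∷ T) p with remove-both S T p
... | j , S′ , T′ , r , r′ , eq , eq′ = Fin.suc j , true ∷ S′ , false ∷ T′ , there r , there r′ , eq , eq′
remove-both (false ∷ S) (b ∷ T) p with remove-both S T p
... | j , S′ , T′ , r , r′ , eq , eq′ = Fin.suc j , false ∷ S′ , b ∷ T′ , there r , there r′ , eq , eq′

remove-outside : (S T : Subset n) → ∣ S ∩ T ∣ < ∣ S ∣ → ∃₂ λ j S′ →
  Remove j S S′ × ∣ S ∩ T ∣ ≡ ∣ S′ ∩ T ∣
remove-outside (true ∷ S) (true ∷ T) p with remove-outside S T (ℕ.s<s⁻¹ p)
... | j , S′ , r , eq = Fin.suc j , true ∷ S′ , there r , cong suc eq
remove-outside (true ∷ S) (false ∷ T) p = Fin.zero , false ∷ S , here , refl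
remove-outside (false ∷ S) (b ∷ T) p with remove-outside S T p
... | j , S′ , r , eq = Fin.suc j , false ∷ S′ , there r , eq

-- An element of S outside T is removed if there is one. Otherwise the intersection is all of S, and
-- losing one element still leaves a ≥ c.
remove-keeping : ∀ {a c} (S T : Subset n) → ∣ S ∣ ≡ suc a → c ≤ ∣ S ∩ T ∣ → c ≤ a →
  ∃₂ λ j S′ → Remove j S S′ × c ≤ ∣ S′ ∩ T ∣
remove-keeping {a = a} S T ∣S∣≡ c≤∩ c≤a with ∣ S ∩ T ∣ ℕ.<? ∣ S ∣
... | yes p with remove-outside S T p
...   | j , S′ , r , eq = j , S′ , r , subst (_ ≤_) eq c≤∩
remove-keeping {a = a} {c} S T ∣S∣≡ c≤∩ c≤a | no ¬p
  with le ← subst (_≤ ∣ S ∩ T ∣) ∣S∣≡ (ℕ.≮⇒≥ ¬p)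
  with remove-both S T (ℕ.≤-trans (s≤s z≤n) le)
... | j , S′ , _ , r , _ , _ , eq =
  j , S′ , r , ℕ.≤-trans c≤a (ℕ.s≤s⁻¹ (subst (suc a ≤_) eq le))

unit-vector : Fin n → Vec ℤ n
unit-vector {suc n} Fin.zero    = 1ℤ ∷ Vec.replicate n 0ℤ
unit-vector         (Fin.suc j) = 0ℤ ∷ unit-vector j

ι-zero : ι (Vec.replicate n 0ℤ) ≡ 0ᴱ
ι-zero {zero}  = refl
ι-zero {suc n} = cong₂ _⊹_ ι-zero (0• 1ᴱ)

lead-unit-vector-⊗ : ∀ {j} {S S′ : Subset n} → Remove j S S′ → (f : E n) →
  Lead UnitCoefficient f S′ → Lead UnitCoefficient (ι (unit-vector j) ⊗ f) S
lead-unit-vector-⊗ {suc n} {S = true ∷ S} here (f ⊹ .0ᴱ) (refl , l) =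
  subst (λ h → Lead UnitCoefficient h S) (sym (begin
    (1ℤ • 1ᴱ) ⊗ f ⊕ bar (ι (Vec.replicate n 0ℤ)) ⊗ 0ᴱ    ≡⟨ cong₂ _⊕_ (cong (_⊗ f) (1• 1ᴱ)) (⊗-zeroʳ _) ⟩
    1ᴱ ⊗ f ⊕ 0ᴱ                                          ≡⟨ ⊕-identityʳ _ ⟩
    1ᴱ ⊗ f                                               ≡⟨ ⊗-identityˡ f ⟩
    f                                                    ∎)) l
lead-unit-vector-⊗ {S = true ∷ S} (there {j = j} r) (f ⊹ g) l =
  subst (λ h → Lead UnitCoefficient h S) (sym (begin
    (0ℤ • 1ᴱ) ⊗ f ⊕ bar (ι (unit-vector j)) ⊗ g    ≡⟨ cong₂ _⊕_ (trans (cong (_⊗ f) (0• 1ᴱ)) (⊗-zeroˡ f)) (cong (_⊗ g) (bar-ι (unit-vector j))) ⟩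
    0ᴱ ⊕ ⊖ ι (unit-vector j) ⊗ g                   ≡⟨ ⊕-identityˡ _ ⟩
    ⊖ ι (unit-vector j) ⊗ g                        ≡⟨ ⊖-⊗ _ g ⟩
    ⊖ (ι (unit-vector j) ⊗ g)                      ∎))
    (lead-⊖ (λ {a} → unit-neg {a}) (ι (unit-vector j) ⊗ g) S (lead-unit-vector-⊗ r g l))
lead-unit-vector-⊗ {S = false ∷ S} (there {j = j} r) (f ⊹ .0ᴱ) (refl , l) =
  (begin
    (0ℤ • 1ᴱ) ⊗ f ⊕ bar (ι (unit-vector j)) ⊗ 0ᴱ    ≡⟨ cong₂ _⊕_ (trans (cong (_⊗ f) (0• 1ᴱ)) (⊗-zeroˡ f)) (⊗-zeroʳ _) ⟩
    0ᴱ ⊕ 0ᴱ                                         ≡⟨ ⊕-identityˡ 0ᴱ ⟩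
    0ᴱ                                              ∎)
  , lead-unit-vector-⊗ r f l

-- Unit vectors are distributed greedily; the condition on intersections
-- guarantees that an index common to A and B finds an element of S ∩ T.
realise-leads : (A B : Subset k) (S T : Subset n) →
  ∣ S ∣ ≡ ∣ A ∣ → ∣ T ∣ ≡ ∣ B ∣ → ∣ A ∩ B ∣ ≤ ∣ S ∩ T ∣ →
  ∃ λ (vs : Vec (Vec ℤ n) k) →
    Lead UnitCoefficient (∏ (select A vs)) S × Lead UnitCoefficient (∏ (select B vs)) T
realise-leads [] [] S T ∣S∣≡0 ∣T∣≡0 _ = [] , empty S ∣S∣≡0 , empty T ∣T∣≡0
  where
  empty : ∀ {n} (S : Subset n) → ∣ S ∣ ≡ 0 → Lead UnitCoefficient 1ᴱ S
  empty []          _  = refl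
  empty (false ∷ S) eq = refl , empty S eq
realise-leads (false ∷ A) (false ∷ B) S T p q r with realise-leads A B S T p q r
... | vs , l , l′ = Vec.replicate _ 0ℤ ∷ vs , l , l′
realise-leads (true ∷ A) (true ∷ B) S T p q r with remove-both S T (ℕ.≤-trans (s≤s z≤n) r)
... | j , S′ , T′ , rS , rT , eq , _
  with realise-leads A B S′ T′ (ℕ.suc-injective (trans (sym (remove-size rS)) p))
         (ℕ.suc-injective (trans (sym (remove-size rT)) q)) (ℕ.s≤s⁻¹ (subst (suc _ ≤_) eq r))
...   | vs , l , l′ = unit-vector j ∷ vs , lead-unit-vector-⊗ rS _ l , lead-unit-vector-⊗ rT _ l′
-- An index of A alone must not use up the elements of S ∩ T reserved for the remaining common
-- indices.
realise-leads (true ∷ A) (false ∷ B) S T p q r with remove-keeping S T p r (Sub.∣p∩q∣≤∣p∣ A B)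
... | j , S′ , rS , le
  with realise-leads A B S′ T (ℕ.suc-injective (trans (sym (remove-size rS)) p)) q le
...   | vs , l , l′ = unit-vector j ∷ vs , lead-unit-vector-⊗ rS _ l , l′
realise-leads (false ∷ A) (true ∷ B) S T p q r
  with remove-keeping T S q (subst (λ R → _ ≤ ∣ R ∣) (Sub.∩-comm S T) r) (Sub.∣p∩q∣≤∣q∣ A B)
... | j , T′ , rT , le
  with realise-leads A B S T′ p (ℕ.suc-injective (trans (sym (remove-size rT)) q))
         (subst (λ R → _ ≤ ∣ R ∣) (Sub.∩-comm T′ S) le)
...   | vs , l , l′ = unit-vector j ∷ vs , l , lead-unit-vector-⊗ rT _ l′

subset-of-size : ∀ {x} n → x ≤ n → ∃ λ (S : Subset n) → ∣ S ∣ ≡ x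
subset-of-size n       z≤n       = Vec.replicate n false , Sub.∣⊥∣≡0 n
subset-of-size (suc n) (s≤s x≤n) with subset-of-size n x≤n
... | S , eq = true ∷ S , cong suc eq

∣S∩∁S∣≡0 : (S : Subset n) → ∣ S ∩ ∁ S ∣ ≡ 0
∣S∩∁S∣≡0 []          = refl
∣S∩∁S∣≡0 (true  ∷ S) = ∣S∩∁S∣≡0 S
∣S∩∁S∣≡0 (false ∷ S) = ∣S∩∁S∣≡0 S

∣prefix∣ : ∀ t (S : Subset n) → ∣ Vec.replicate t true Vec.++ S ∣ ≡ t ℕ.+ ∣ S ∣
∣prefix∣ zero    S = refl
∣prefix∣ (suc t) S = cong suc (∣prefix∣ t S)

∣prefix∩prefix∣ : ∀ t (S T : Subset n) →
  t ≤ ∣ (Vec.replicate t true Vec.++ S) ∩ (Vec.replicate t true Vec.++ T) ∣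
∣prefix∩prefix∣ zero    S T = z≤n
∣prefix∩prefix∣ (suc t) S T = s≤s (∣prefix∩prefix∣ t S T)

-- The two products are given leading monomials consisting of the first t generators together with X
-- and with its complement. They share t generators, enough for the common indices of A and B; `top`
-- strips these off, and X and its complement are disjoint.
form-unit : ∀ t {x y} (A B : Subset k) → ∣ A ∣ ≡ t ℕ.+ x → ∣ B ∣ ≡ t ℕ.+ y → x ℕ.+ y ≡ n →
  ∣ A ∩ B ∣ ≤ t →
  ∃ λ (vs : Vec (Vec ℤ (t ℕ.+ n)) k) → ∃ λ S →
    Lead UnitCoefficient (form t vs A ⊗ form t vs B) S
form-unit {n = n} t {x} {y} A B ∣A∣≡ ∣B∣≡ x+y≡n ∣A∩B∣≤t
  with X , ∣X∣≡ ← subset-of-size n (ℕ.m+n≤o⇒m≤o x (ℕ.≤-reflexive x+y≡n))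
  with realise-leads A B (Vec.replicate t true Vec.++ X) (Vec.replicate t true Vec.++ ∁ X)
         (trans (∣prefix∣ t X) (trans (cong (t ℕ.+_) ∣X∣≡) (sym ∣A∣≡)))
         (trans (∣prefix∣ t (∁ X)) (trans (cong (t ℕ.+_) (trans (Sub.∣∁p∣≡n∸∣p∣ X)
           (trans (cong₂ ℕ._∸_ (sym x+y≡n) ∣X∣≡) (ℕ.m+n∸m≡n x y)))) (sym ∣B∣≡)))
         (ℕ.≤-trans ∣A∩B∣≤t (∣prefix∩prefix∣ t X (∁ X)))
... | vs , l , l′ = vs , X ∪ ∁ X ,
  lead-⊗ (λ {a} → unit-neg {a}) (λ {a} {b} → unit-* {a} {b}) (form t vs A) (form t vs B) X (∁ X) (∣S∩∁S∣≡0 X)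
    (lead-top t (∏ (select A vs)) X l) (lead-top t (∏ (select B vs)) (∁ X) l′)

-- Every modulus is one more than the product of the preceding ones, which is thus
-- −1 modulo it: Chinese remaindering needs no inverses.
sylvester-product : ℕ → ℕ
sylvester-product zero    = 1
sylvester-product (suc m) = sylvester-product m ℕ.* suc (sylvester-product m)

sylvester : Fin m → ℕ
sylvester {suc m} Fin.zero    = suc (sylvester-product m)
sylvester {suc m} (Fin.suc i) = sylvester i

sylvester-product≥1 : ∀ m → 1 ≤ sylvester-product m
sylvester-product≥1 zero    = ℕ.≤-refl
sylvester-product≥1 (suc m) = ℕ.*-mono-≤ (sylvester-product≥1 m) (s≤s z≤n)

sylvester≥2 : (i : Fin m) → 2 ≤ sylvester i
sylvester≥2 {suc m} Fin.zero    = s≤s (sylvester-product≥1 m)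
sylvester≥2 {suc m} (Fin.suc i) = sylvester≥2 i

sylvester-divides : (i : Fin m) → ∃ λ q → sylvester-product m ≡ sylvester i ℕ.* q
sylvester-divides {suc m} Fin.zero    = sylvester-product m , ℕ.*-comm (sylvester-product m) _
sylvester-divides {suc m} (Fin.suc i) with sylvester-divides i
... | q , eq = q ℕ.* suc (sylvester-product m) ,
  trans (cong (ℕ._* suc (sylvester-product m)) eq) (ℕ.*-assoc (sylvester i) q _)

chinese-remainder : (w : Fin m → ℤ) → ∃ λ y → ∀ i → ∃ λ h → y ≡ w i ℤ.+ (ℤ.+ sylvester i) ℤ.* h
chinese-remainder {zero}  w = 0ℤ , λ ()
chinese-remainder {suc m} w with chinese-remainder (λ i → w (Fin.suc i))
-- Adding a multiple of Q preserves the residues already achieved. Modulo Q + 1 the factor Q is -1,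
-- so the sum becomes y - (y - w₀) = w₀.
... | y , cong-y = y ℤ.+ Q ℤ.* (y ℤ.- w₀) , λ
  { Fin.zero    → y ℤ.- w₀ , first y w₀ Q
  ; (Fin.suc i) → let h , eq = cong-y i ; q , eq′ = sylvester-divides i in
      h ℤ.+ (ℤ.+ q) ℤ.* (y ℤ.- w₀) ,
      trans (cong₂ (λ a b → a ℤ.+ b ℤ.* (y ℤ.- w₀)) eq
              (trans (cong ℤ.+_ eq′) (ℤ.pos-* (sylvester i) q)))
            (rest (w (Fin.suc i)) (ℤ.+ sylvester i) h (ℤ.+ q) (y ℤ.- w₀)) }
  where
  w₀ = w Fin.zero
  Q = ℤ.+ sylvester-product m
  first : ∀ y w Q → y ℤ.+ Q ℤ.* (y ℤ.- w) ≡ w ℤ.+ (1ℤ ℤ.+ Q) ℤ.* (y ℤ.- w)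
  first = ℤ-Solver.solve-∀
  rest : ∀ w p h q d → (w ℤ.+ p ℤ.* h) ℤ.+ (p ℤ.* q) ℤ.* d ≡ w ℤ.+ p ℤ.* (h ℤ.+ q ℤ.* d)
  rest = ℤ-Solver.solve-∀

_≡_mod_ : Vec ℤ n → Vec ℤ n → ℤ → Set
u ≡ v mod p = ∃ λ h → u ≡ lincomb 1ℤ p v h

chinese-remainder-vector : (w : Fin m → Vec ℤ n) → ∃ λ y → ∀ i → y ≡ w i mod (ℤ.+ sylvester i)
chinese-remainder-vector {n = zero} w = [] , λ i → [] , empty {ℤ.+ sylvester i} (w i)
  where
  empty : ∀ {p} (v : Vec ℤ 0) → [] ≡ lincomb 1ℤ p v []
  empty [] = refl
chinese-remainder-vector {m} {suc n} w
  with y , eq ← chinese-remainder (λ i → Vec.head (w i))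
  with ys , eqs ← chinese-remainder-vector (λ i → Vec.tail (w i))
  = y ∷ ys , λ i → combine {ℤ.+ sylvester i} (w i) (eq i) (eqs i)
  where
  combine : ∀ {p y} {ys : Vec ℤ n} (v : Vec ℤ (suc n)) → (∃ λ h → y ≡ Vec.head v ℤ.+ p ℤ.* h) →
            ys ≡ Vec.tail v mod p → (y ∷ ys) ≡ v mod p
  combine (x ∷ v) (h , eq) (hs , eqs) =
    h ∷ hs , cong₂ _∷_ (trans eq (cong (ℤ._+ _) (sym (ℤ.*-identityˡ x)))) eqs

chinese-remainder-matrix : (w : Fin m → Vec (Vec ℤ n) k) →
  ∃ λ (ys : Vec (Vec ℤ n) k) → ∀ i → Pointwise (λ u v → u ≡ v mod (ℤ.+ sylvester i)) ys (w i)
chinese-remainder-matrix {k = zero} w = [] , λ i → empty (w i)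
  where
  empty : ∀ {R : Vec ℤ n → Vec ℤ n → Set} (v : Vec (Vec ℤ n) 0) → Pointwise R [] v
  empty [] = []
chinese-remainder-matrix {k = suc k} w
  with y , eq ← chinese-remainder-vector (λ i → Vec.head (w i))
  with ys , eqs ← chinese-remainder-matrix (λ i → Vec.tail (w i))
  = y ∷ ys , λ i → combine (w i) (eq i) (eqs i)
  where
  combine : ∀ {R : Vec ℤ n → Vec ℤ n → Set} {y} {ys : Vec (Vec ℤ n) k} (v : Vec (Vec ℤ n) (suc k)) →
            R y (Vec.head v) → Pointwise R ys (Vec.tail v) → Pointwise R (y ∷ ys) v
  combine (x ∷ v) r rs = r ∷ rs

-- Congruence of forms and nonvanishing

Congruent : ℤ → E n → E n → Set
Congruent p f g = ∃ λ h → f ≡ g ⊕ p • h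

module _ {p : ℤ} where

  congruent-refl : (f : E n) → Congruent p f f
  congruent-refl f = 0ᴱ , sym (trans (cong (f ⊕_) (•-0ᴱ p)) (⊕-identityʳ f))

  congruent-⊗ : {f f′ g g′ : E n} → Congruent p f f′ → Congruent p g g′ → Congruent p (f ⊗ g) (f′ ⊗ g′)
  congruent-⊗ {f = f} {f′} {g} {g′} (h , eq) (h′ , eq′) = f′ ⊗ h′ ⊕ h ⊗ g , (begin
    f ⊗ g                                          ≡⟨ cong (_⊗ g) eq ⟩
    (f′ ⊕ p • h) ⊗ g                               ≡⟨ ⊗-distribʳ g _ _ ⟩
    f′ ⊗ g ⊕ (p • h) ⊗ g                           ≡⟨ cong₂ _⊕_ (cong (f′ ⊗_) eq′) (•-⊗ p h g) ⟩
    f′ ⊗ (g′ ⊕ p • h′) ⊕ p • (h ⊗ g)               ≡⟨ cong (_⊕ p • (h ⊗ g)) (⊗-distribˡ f′ _ _) ⟩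
    f′ ⊗ g′ ⊕ f′ ⊗ (p • h′) ⊕ p • (h ⊗ g)          ≡⟨ ⊕-assoc _ _ _ ⟩
    f′ ⊗ g′ ⊕ (f′ ⊗ (p • h′) ⊕ p • (h ⊗ g))        ≡⟨ cong (λ e → f′ ⊗ g′ ⊕ (e ⊕ p • (h ⊗ g))) (⊗-• p f′ h′) ⟩
    f′ ⊗ g′ ⊕ (p • (f′ ⊗ h′) ⊕ p • (h ⊗ g))        ≡⟨ cong (f′ ⊗ g′ ⊕_) (•-⊕ p _ _) ⟨
    f′ ⊗ g′ ⊕ p • (f′ ⊗ h′ ⊕ h ⊗ g)                ∎)

  congruent-ι : {u v : Vec ℤ n} → u ≡ v mod p → Congruent p (ι u) (ι v)
  congruent-ι {v = v} (h , refl) = ι h , trans (ι-lincomb 1ℤ p v h) (cong (_⊕ p • ι h) (1• (ι v)))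

  congruent-∏ : {us vs : Vec (Vec ℤ n) k} → Pointwise (λ u v → u ≡ v mod p) us vs →
                (S : Subset k) → Congruent p (∏ (select S us)) (∏ (select S vs))
  congruent-∏ []       []          = congruent-refl 1ᴱ
  congruent-∏ (r ∷ rs) (true  ∷ S) = congruent-⊗ (congruent-ι r) (congruent-∏ rs S)
  congruent-∏ (r ∷ rs) (false ∷ S) = congruent-∏ rs S

  congruent-form : ∀ t {us vs : Vec (Vec ℤ (t ℕ.+ n)) k} → Pointwise (λ u v → u ≡ v mod p) us vs →
                   (S : Subset k) → Congruent p (form t us S) (form t vs S)
  congruent-form t {us} {vs} r S with congruent-∏ r S
  ... | h , eq = top t h , trans (cong (top t) eq)
    (trans (top-⊕ t _ _) (cong (form t vs S ⊕_) (top-• t p h)))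

-- At the leading monomial of f the equation would read ±1 + p h = 0, so that p divides 1.
unit-not-multiple : ∀ {p} → 2 ≤ p → (f h : E n) (S : Subset n) → Lead UnitCoefficient f S →
                    f ⊕ (ℤ.+ p) • h ≢ 0ᴱ
unit-not-multiple {p = p} 2≤p (scalar a) (scalar h) [] unit eq = ℕ.<-irrefl (sym p≡1) 2≤p
  where
  a+ph≡0 : a ℤ.+ (ℤ.+ p) ℤ.* h ≡ 0ℤ
  a+ph≡0 = scalar-injective eq
  a≡-ph : a ≡ ℤ.- ((ℤ.+ p) ℤ.* h)
  a≡-ph = ℤ.i-j≡0⇒i≡j a _ (trans (cong (λ b → a ℤ.+ b) (ℤ.neg-involutive _)) a+ph≡0)
  p*∣h∣≡1 : p ℕ.* ℤ.∣ h ∣ ≡ 1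
  p*∣h∣≡1 = begin
    p ℕ.* ℤ.∣ h ∣           ≡⟨ ℤ.abs-* (ℤ.+ p) h ⟨
    ℤ.∣ (ℤ.+ p) ℤ.* h ∣     ≡⟨ ℤ.∣-i∣≡∣i∣ ((ℤ.+ p) ℤ.* h) ⟨
    ℤ.∣ ℤ.- ((ℤ.+ p) ℤ.* h) ∣ ≡⟨ cong ℤ.∣_∣ a≡-ph ⟨
    ℤ.∣ a ∣                 ≡⟨ unit ⟩
    1                       ∎
  p≡1 : p ≡ 1
  p≡1 = ℕ.m*n≡1⇒m≡1 p ℤ.∣ h ∣ p*∣h∣≡1
unit-not-multiple 2≤p (f ⊹ g) (h ⊹ h′) (true ∷ S) l eq =
  unit-not-multiple 2≤p g h′ S l (⊹-injectiveʳ eq)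
unit-not-multiple 2≤p (f ⊹ g) (h ⊹ h′) (false ∷ S) (_ , l) eq =
  unit-not-multiple 2≤p f h S l (⊹-injectiveˡ eq)

-- Forms are integral polynomials in the entries of the vectors, so matrices congruent modulo
-- `sylvester i` yield congruent forms. One matrix thus inherits nonvanishing from the matrix
-- tailored to each pair.
general-position : ∀ t (A B : Fin m → Subset k) (x y : Fin m → ℕ) →
  (∀ i → ∣ A i ∣ ≡ t ℕ.+ x i) → (∀ i → ∣ B i ∣ ≡ t ℕ.+ y i) → (∀ i → x i ℕ.+ y i ≡ n) →
  (∀ i → ∣ A i ∩ B i ∣ ≤ t) →
  ∃ λ (vs : Vec (Vec ℤ (t ℕ.+ n)) k) → ∀ i → form t vs (A i) ⊗ form t vs (B i) ≢ 0ᴱ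
general-position t A B x y ∣A∣≡ ∣B∣≡ x+y≡n ∣A∩B∣≤t = vs , λ i ωη≡0 →
  let S , l = proj₂ (special i)
      h , eq = congruent-⊗ {ℤ.+ sylvester i} (congruent-form t (vs≡ i) (A i)) (congruent-form t (vs≡ i) (B i))
  in unit-not-multiple (sylvester≥2 i) _ h S l (trans (sym eq) ωη≡0)
  where
  special : ∀ i → _
  special i = form-unit t (A i) (B i) (∣A∣≡ i) (∣B∣≡ i) (x+y≡n i) (∣A∩B∣≤t i)
  crt = chinese-remainder-matrix (λ i → proj₁ (special i))
  vs = proj₁ crt
  vs≡ = proj₂ crt

theorem1p5 : (m t N n : ℕ) → .{{_ : NonZero m}} → .{{_ : NonZero N}} →
    (A B : Fin m → Subset n) →
    (a≤b : ∀ i → ∣ A i ∣ ≤ ∣ B i ∣) →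
    (AA>t : ∀ i j → ∣ A i ∩ A j ∣ > t) →
    (∀ i → ∣ A i ∩ B i ∣ ≤ t) →
    (∀ i j → i Fin.< j → ∣ A i ∩ B j ∣ > t) →
    (a+b≡N : ∀ i → ∣ A i ∣ + ∣ B i ∣ ≡ N) →
    (∀ i j → i Fin.≤ j → ∣ A i ∣ ≤ ∣ A j ∣) →
    (∑[ i < m ] (_/_ (+ 1) ((N ∸ (2 * t + 1)) C (∣ A i ∣ ∸ (t + 1))) {{binomial-nonZero (A i) (B i) (AA>t i i) (a≤b i) (a+b≡N i)}})) ℚ.≤ 1ℚ
theorem1p5 m t N n A B a≤b AA>t AB≤t AB>t a+b≡N mono =
  -- The sets S i exist only under a double negation, which decidability of the inequality removes.
  decidable-stable (_ ℚ.≤? 1ℚ) λ ≰1 →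
    let vs , ωη≢0 = general-position t A B (λ i → suc (d i)) y ∣A∣≡ ∣B∣≡ x+y≡ AB≤t
    in intersecting-antichain (λ i → form t vs (A i)) (λ i → form t vs (B i)) (λ i → suc (d i))
         (λ i → hom-form t (suc (d i)) vs (A i) (∣A∣≡ i))
         (λ i → form-gradedCentral t vs (A i))
         (λ i j → form-vanishing t vs (A i) (A j) (AA>t i j))
         (λ i j i<j → form-vanishing t vs (A i) (B j) (AB>t i j i<j))
         ωη≢0 (λ i j i≤j → s≤s (d-mono i j i≤j))
         λ (S , size , meets , antichain) → ≰1
           (∑-reciprocals≤1 (λ i → M C d i) (λ i → d i ! * (M ∸ d i) !)
             (λ i → binomial-nonZero (A i) (B i) (AA>t i i) (a≤b i) (a+b≡N i)) (M !) {{M ℕ.!≢0}}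
             (λ i → nCk*k![n∸k]!≡n! (d≤M i))
             (greene-katona-kleitman S d size half meets antichain d-mono))
  where
  M : ℕ
  M = N ∸ (2 * t + 1)
  -- The forms of A i and B i have the complementary degrees `suc (d i)` and `y i` in dimension
  -- `suc M` = N - 2t; d is the lower entry of the binomial coefficient.
  d y : Fin m → ℕ
  d i = ∣ A i ∣ ∸ (t + 1)
  y i = ∣ B i ∣ ∸ t
  ∣A∣≡ : ∀ i → ∣ A i ∣ ≡ t + suc (d i)
  ∣A∣≡ i = trans (sym (ℕ.m+[n∸m]≡n (t+1≤∣A∣ (A i) (B i) (AA>t i i) (a≤b i) (a+b≡N i)))) (ℕ.+-assoc t 1 (d i))
  ∣B∣≡ : ∀ i → ∣ B i ∣ ≡ t + y i
  ∣B∣≡ i = sym (ℕ.m+[n∸m]≡n (ℕ.≤-trans (ℕ.m≤m+n t (suc (d i))) (subst (_≤ ∣ B i ∣) (∣A∣≡ i) (a≤b i))))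
  x+y≡ : ∀ i → suc (d i) + y i ≡ suc M
  x+y≡ i = ℕ.+-cancelˡ-≡ (2 * t) _ _ (begin
    2 * t + (suc (d i) + y i)          ≡⟨ regroup t (suc (d i)) (y i) ⟩
    (t + suc (d i)) + (t + y i)        ≡⟨ cong₂ _+_ (∣A∣≡ i) (∣B∣≡ i) ⟨
    ∣ A i ∣ + ∣ B i ∣                  ≡⟨ a+b≡N i ⟩
    N                                  ≡⟨ ℕ.m+[n∸m]≡n (2t+1≤N (A i) (B i) (AA>t i i) (a≤b i) (a+b≡N i)) ⟨
    2 * t + 1 + M                      ≡⟨ ℕ.+-assoc (2 * t) 1 M ⟩
    2 * t + suc M                      ∎)
    where
    open ≡-Reasoning
    regroup : ∀ t x y → 2 * t + (x + y) ≡ (t + x) + (t + y)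
    regroup = ℕ-Solver.solve-∀
  -- Subtracting t from both sides of a_i ≤ b_i gives `suc (d i)` ≤ `y i`, and these two add up to
  -- `suc M`.
  half : ∀ i → suc (d i) + suc (d i) ≤ suc M
  half i = subst (suc (d i) + suc (d i) ≤_) (x+y≡ i) (ℕ.+-monoʳ-≤ (suc (d i))
    (ℕ.+-cancelˡ-≤ t _ _ (subst₂ _≤_ (∣A∣≡ i) (∣B∣≡ i) (a≤b i))))
  d≤M : ∀ i → d i ≤ M
  d≤M i = ℕ.s≤s⁻¹ (ℕ.≤-trans (ℕ.m≤m+n (suc (d i)) (suc (d i))) (half i))
  d-mono : ∀ i j → i Fin.≤ j → d i ≤ d j
  d-mono i j i≤j = ℕ.∸-monoˡ-≤ (t + 1) (mono i j i≤j)
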